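{- Let $I,J\subseteq\mathbb{R}$ be open intervals, let $y:I\to J$ and $g:J\to\mathbb{R}$ be infinitely differentiable functions, and let $f(x)=g(y(x))$ for $x\in I$. Consider the ordinary generating functions (formal power series in $z$) $$F(x,z)=\sum_{n\ge 0}\frac{f^{(n)}(x)}{n!}z^n,\qquad Y(x,z)=\sum_{n\ge 1}\frac{y^{(n)}(x)}{n!}z^n\qquad (x\in I),$$ $$G(u,z)=\sum_{n\ge 0}\frac{g^{(n)}(u)}{n!}z^n\qquad (u\in J).$$ Then for every $x\in I$, $$F(x,z)=G\bigl(y(x),\,Y(x,z)\bigr)$$ as formal power series in $z$, where the right-hand side is the formal power series $G(y(x),\cdot)=\sum_{n\ge 0}\frac{g^{(n)}(y(x))}{n!}(\cdot)^n$ with $Y(x,z)$ substituted for its formal variable.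
   Context: Here $h^{(n)}$ denotes the $n$-th derivative, with $h^{(0)}=h$. The series $Y(x,z)$ has zero constant term in $z$, so substituting it into a formal power series is well defined. -}

module Defs where

open import Data.Integer.Base using (+_)
open import Data.Maybe.Base using (Maybe)
open import Data.Maybe.Relation.Unary.All using (All)
open import Data.Nat.Base as ℕ using (ℕ; zero; suc; _!)
import Data.Nat.Properties as ℕ
open import Data.Product using (Σ; ∃-syntax; _×_; _,_; proj₁; proj₂)
open import Data.Rational as ℚ using (ℚ; 0ℚ; 1ℚ; ½)
import Data.Rational.Properties as ℚ
open import Data.Rational.Solver using (module +-*-Solver)
open import Data.Sum.Base using (inj₁; inj₂)
open import Function.Base using (_on_)
open import Function.Bundles using (Func)
import Function.Construct.Composition as Composition
open import Level using (0ℓ)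
open import Relation.Binary.Bundles using (Setoid)
import Relation.Binary.Construct.On as On
open import Relation.Binary.PropositionalEquality
  using (_≡_; _≢_; refl; sym; trans; cong; cong₂; subst; subst₂; module ≡-Reasoning)
open import Relation.Nullary using (yes; no; contradiction)

open Func using (to)
open +-*-Solver using (solve; _:+_; _:*_; _:-_; :-_; _:=_)

private
  resp-∣∣≤ : ∀ {p q r} → p ≡ q → ℚ.∣ p ∣ ℚ.≤ r → ℚ.∣ q ∣ ℚ.≤ r
  resp-∣∣≤ refl p≤r = p≤r

  ½-pos : ∀ {ε} → 0ℚ ℚ.< ε → 0ℚ ℚ.< ½ ℚ.* ε
  ½-pos {ε} ε>0 = ℚ.*-monoʳ-<-pos ½ ε>0

  ½+½ : ∀ ε → ½ ℚ.* ε ℚ.+ ½ ℚ.* ε ≡ ε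
  ½+½ ε = trans (sym (ℚ.*-distribʳ-+ ε ½ ½)) (ℚ.*-identityˡ ε)

  add-< : ∀ {p q r ε} → p ℚ.≤ q ℚ.+ r → q ℚ.< ½ ℚ.* ε → r ℚ.< ½ ℚ.* ε → p ℚ.< ε
  add-< {ε = ε} p≤ q< r< = ℚ.≤-<-trans p≤ (subst (_ ℚ.<_) (½+½ ε) (ℚ.+-mono-< q< r<))

  ∣p-q∣-sym : ∀ p q → ℚ.∣ p ℚ.- q ∣ ≡ ℚ.∣ q ℚ.- p ∣
  ∣p-q∣-sym p q = trans (cong ℚ.∣_∣ (solve 2 (λ p q → p :- q := :- (q :- p)) refl p q))
                        (ℚ.∣-p∣≡∣p∣ (q ℚ.- p))

  ∣p-r∣-triangle : ∀ p q r → ℚ.∣ p ℚ.- r ∣ ℚ.≤ ℚ.∣ p ℚ.- q ∣ ℚ.+ ℚ.∣ q ℚ.- r ∣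
  ∣p-r∣-triangle p q r = resp-∣∣≤
    (solve 3 (λ p q r → (p :- q) :+ (q :- r) := p :- r) refl p q r)
    (ℚ.∣p+q∣≤∣p∣+∣q∣ (p ℚ.- q) (q ℚ.- r))

  ∣p∣≤∣q∣+∣p-q∣ : ∀ p q → ℚ.∣ p ∣ ℚ.≤ ℚ.∣ q ∣ ℚ.+ ℚ.∣ p ℚ.- q ∣
  ∣p∣≤∣q∣+∣p-q∣ p q = resp-∣∣≤
    (solve 2 (λ p q → q :+ (p :- q) := p) refl p q)
    (ℚ.∣p+q∣≤∣p∣+∣q∣ q (p ℚ.- q))

  ∣p∣-∣q∣≤∣p-q∣ : ∀ p q → ℚ.∣ p ∣ ℚ.- ℚ.∣ q ∣ ℚ.≤ ℚ.∣ p ℚ.- q ∣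
  ∣p∣-∣q∣≤∣p-q∣ p q = subst (ℚ.∣ p ∣ ℚ.- ℚ.∣ q ∣ ℚ.≤_)
    (solve 2 (λ a b → (a :+ b) :- a := b) refl ℚ.∣ q ∣ ℚ.∣ p ℚ.- q ∣)
    (ℚ.+-monoˡ-≤ (ℚ.- ℚ.∣ q ∣) (∣p∣≤∣q∣+∣p-q∣ p q))

  ∣∣p∣-∣q∣∣≤∣p-q∣ : ∀ p q → ℚ.∣ ℚ.∣ p ∣ ℚ.- ℚ.∣ q ∣ ∣ ℚ.≤ ℚ.∣ p ℚ.- q ∣
  ∣∣p∣-∣q∣∣≤∣p-q∣ p q with ℚ.∣p∣≡p∨∣p∣≡-p (ℚ.∣ p ∣ ℚ.- ℚ.∣ q ∣)
  ... | inj₁ eq = subst (ℚ._≤ ℚ.∣ p ℚ.- q ∣) (sym eq) (∣p∣-∣q∣≤∣p-q∣ p q)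
  ... | inj₂ eq = subst₂ ℚ._≤_
    (sym (trans eq (solve 2 (λ a b → :- (a :- b) := b :- a) refl ℚ.∣ p ∣ ℚ.∣ q ∣)))
    (∣p-q∣-sym q p) (∣p∣-∣q∣≤∣p-q∣ q p)

  ∣p∣-cauchy-bound : ∀ {p q r} → ℚ.∣ p ℚ.- q ∣ ℚ.< r → ℚ.∣ p ∣ ℚ.≤ ℚ.∣ q ∣ ℚ.+ r
  ∣p∣-cauchy-bound {p} {q} p-q<r =
    ℚ.≤-trans (∣p∣≤∣q∣+∣p-q∣ p q) (ℚ.+-monoʳ-≤ ℚ.∣ q ∣ (ℚ.<⇒≤ p-q<r))

  ∣p∣+1>0 : ∀ p → 0ℚ ℚ.< ℚ.∣ p ∣ ℚ.+ 1ℚ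
  ∣p∣+1>0 p = ℚ.+-mono-≤-< (ℚ.0≤∣p∣ p) (ℚ.positive⁻¹ 1ℚ)

  *-pos : ∀ {p q} → 0ℚ ℚ.< p → 0ℚ ℚ.< q → 0ℚ ℚ.< p ℚ.* q
  *-pos {p} {q} p>0 q>0 = ℚ.positive⁻¹ (p ℚ.* q)
    {{ℚ.pos*pos⇒pos p {{ℚ.positive p>0}} q {{ℚ.positive q>0}}}}

  split : ∀ {B ε} → 0ℚ ℚ.< B → 0ℚ ℚ.< ε → ∃[ δ ] 0ℚ ℚ.< δ × B ℚ.* δ ≡ ε
  split {B} {ε} B>0 ε>0 =
    B⁻¹ ℚ.* ε , *-pos (ℚ.positive⁻¹ B⁻¹ {{ℚ.1/pos⇒pos B}}) ε>0 ,
    trans (sym (ℚ.*-assoc B B⁻¹ ε))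
      (trans (cong (ℚ._* ε) (ℚ.*-inverseʳ B {{ℚ.pos⇒nonZero B}})) (ℚ.*-identityˡ ε))
    where
    instance _ = ℚ.positive B>0
    B⁻¹ = (ℚ.1/ B) {{ℚ.pos⇒nonZero B}}

  *-bound-< : ∀ {p B e δ} → 0ℚ ℚ.< B → ℚ.∣ p ∣ ℚ.≤ B → ℚ.∣ e ∣ ℚ.< δ →
              ℚ.∣ p ℚ.* e ∣ ℚ.< B ℚ.* δ
  *-bound-< {p} {B} {e} B>0 p≤B e<δ = subst (ℚ._< _) (sym (ℚ.∣p*q∣≡∣p∣*∣q∣ p e))
    (ℚ.≤-<-trans
      (ℚ.*-monoʳ-≤-nonNeg ℚ.∣ e ∣ {{ℚ.∣-∣-nonNeg e}} p≤B)
      (ℚ.*-monoʳ-<-pos B {{ℚ.positive B>0}} e<δ))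

  ∣ps-qt∣≤ : ∀ p s q t → ℚ.∣ p ℚ.* s ℚ.- q ℚ.* t ∣ ℚ.≤
             ℚ.∣ p ℚ.* (s ℚ.- t) ∣ ℚ.+ ℚ.∣ t ℚ.* (p ℚ.- q) ∣
  ∣ps-qt∣≤ p s q t = resp-∣∣≤
    (solve 4 (λ p s q t → p :* (s :- t) :+ t :* (p :- q) := p :* s :- q :* t) refl p s q t)
    (ℚ.∣p+q∣≤∣p∣+∣q∣ (p ℚ.* (s ℚ.- t)) (t ℚ.* (p ℚ.- q)))

  *-close : ∀ {p s q t B C δ η ε} → 0ℚ ℚ.< B → 0ℚ ℚ.< C →
            B ℚ.* δ ≡ ½ ℚ.* ε → C ℚ.* η ≡ ½ ℚ.* ε →
            ℚ.∣ p ∣ ℚ.≤ B → ℚ.∣ t ∣ ℚ.≤ C → ℚ.∣ s ℚ.- t ∣ ℚ.< δ → ℚ.∣ p ℚ.- q ∣ ℚ.< η →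
            ℚ.∣ p ℚ.* s ℚ.- q ℚ.* t ∣ ℚ.< ε
  *-close {p} {s} {q} {t} B>0 C>0 Bδ≡ Cη≡ p≤B t≤C s-t<δ p-q<η = add-< (∣ps-qt∣≤ p s q t)
    (subst (ℚ.∣ p ℚ.* (s ℚ.- t) ∣ ℚ.<_) Bδ≡ (*-bound-< {p} {e = s ℚ.- t} B>0 p≤B s-t<δ))
    (subst (ℚ.∣ t ℚ.* (p ℚ.- q) ∣ ℚ.<_) Cη≡ (*-bound-< {t} {e = p ℚ.- q} C>0 t≤C p-q<η))

-- The value at 0 is junk: inv below is unaffected by it, as only finitely many terms
-- of its argument can be 0.
recip : ℚ → ℚ
recip p with p ℚ.≟ 0ℚ
... | yes _  = 0ℚ
... | no p≢0 = (ℚ.1/ p) {{ℚ.≢-nonZero p≢0}}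

private
  *-recip : ∀ p → p ≢ 0ℚ → p ℚ.* recip p ≡ 1ℚ
  *-recip p p≢0 with p ℚ.≟ 0ℚ
  ... | yes p≡0 = contradiction p≡0 p≢0
  ... | no  p≢0 = ℚ.*-inverseʳ p {{ℚ.≢-nonZero p≢0}}

  away-≢0 : ∀ {c p} → 0ℚ ℚ.< c → c ℚ.≤ ℚ.∣ p ∣ → p ≢ 0ℚ
  away-≢0 c>0 c≤∣p∣ refl = ℚ.<-irrefl refl (ℚ.<-≤-trans c>0 c≤∣p∣)

  pq∣1/p-1/q∣ : ∀ {p q} → p ≢ 0ℚ → q ≢ 0ℚ →
                (ℚ.∣ p ∣ ℚ.* ℚ.∣ q ∣) ℚ.* ℚ.∣ recip p ℚ.- recip q ∣ ≡ ℚ.∣ q ℚ.- p ∣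
  pq∣1/p-1/q∣ {p} {q} p≢0 q≢0 = begin
    (ℚ.∣ p ∣ ℚ.* ℚ.∣ q ∣) ℚ.* ℚ.∣ recip p ℚ.- recip q ∣
      ≡⟨ cong (ℚ._* ℚ.∣ recip p ℚ.- recip q ∣) (sym (ℚ.∣p*q∣≡∣p∣*∣q∣ p q)) ⟩
    ℚ.∣ p ℚ.* q ∣ ℚ.* ℚ.∣ recip p ℚ.- recip q ∣
      ≡⟨ sym (ℚ.∣p*q∣≡∣p∣*∣q∣ (p ℚ.* q) (recip p ℚ.- recip q)) ⟩
    ℚ.∣ (p ℚ.* q) ℚ.* (recip p ℚ.- recip q) ∣
      ≡⟨ cong ℚ.∣_∣ (solve 4 (λ p q a b → (p :* q) :* (a :- b) := (p :* a) :* q :- (q :* b) :* p)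
                             refl p q (recip p) (recip q)) ⟩
    ℚ.∣ (p ℚ.* recip p) ℚ.* q ℚ.- (q ℚ.* recip q) ℚ.* p ∣
      ≡⟨ cong₂ (λ a b → ℚ.∣ a ℚ.* q ℚ.- b ℚ.* p ∣) (*-recip p p≢0) (*-recip q q≢0) ⟩
    ℚ.∣ 1ℚ ℚ.* q ℚ.- 1ℚ ℚ.* p ∣
      ≡⟨ cong₂ (λ a b → ℚ.∣ a ℚ.- b ∣) (ℚ.*-identityˡ q) (ℚ.*-identityˡ p) ⟩
    ℚ.∣ q ℚ.- p ∣ ∎
    where open ≡-Reasoning

  recip-close : ∀ {c ε p q} → 0ℚ ℚ.< c → c ℚ.≤ ℚ.∣ p ∣ → c ℚ.≤ ℚ.∣ q ∣ →
                ℚ.∣ p ℚ.- q ∣ ℚ.< (c ℚ.* c) ℚ.* ε → ℚ.∣ recip p ℚ.- recip q ∣ ℚ.< ε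
  recip-close {c} {ε} {p} {q} c>0 c≤p c≤q close =
    ℚ.*-cancelˡ-<-nonNeg (c ℚ.* c) {{ℚ.nonNegative (ℚ.<⇒≤ (*-pos c>0 c>0))}}
      (ℚ.≤-<-trans cc≤pq close′)
    where
    d = ℚ.∣ recip p ℚ.- recip q ∣
    c≥0 = ℚ.nonNegative (ℚ.<⇒≤ c>0)
    cc≤pq : (c ℚ.* c) ℚ.* d ℚ.≤ (ℚ.∣ p ∣ ℚ.* ℚ.∣ q ∣) ℚ.* d
    cc≤pq = ℚ.*-monoʳ-≤-nonNeg d {{ℚ.∣-∣-nonNeg (recip p ℚ.- recip q)}}
      (ℚ.≤-trans (ℚ.*-monoʳ-≤-nonNeg c {{c≥0}} c≤p)
                 (ℚ.*-monoˡ-≤-nonNeg ℚ.∣ p ∣ {{ℚ.∣-∣-nonNeg p}} c≤q))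
    close′ : (ℚ.∣ p ∣ ℚ.* ℚ.∣ q ∣) ℚ.* d ℚ.< (c ℚ.* c) ℚ.* ε
    close′ = subst (ℚ._< (c ℚ.* c) ℚ.* ε)
      (sym (trans (pq∣1/p-1/q∣ (away-≢0 c>0 c≤p) (away-≢0 c>0 c≤q)) (∣p-q∣-sym q p))) close

Eventually : (ℕ → Set) → Set
Eventually P = ∃[ N ] ∀ n → N ℕ.≤ n → P n

IsCauchy : (ℕ → ℚ) → Set
IsCauchy s = ∀ ε → 0ℚ ℚ.< ε →
  ∃[ N ] ∀ m n → N ℕ.≤ m → N ℕ.≤ n → ℚ.∣ s m ℚ.- s n ∣ ℚ.< ε

-- Equality of reals is _≃_, not _≡_.
record ℝ : Set where
  constructor mkℝ
  field
    seq    : ℕ → ℚ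
    cauchy : IsCauchy seq

open ℝ public

infix 4 _≃_ _<_

_≃_ : ℝ → ℝ → Set
x ≃ y = ∀ ε → 0ℚ ℚ.< ε → Eventually λ n → ℚ.∣ seq x n ℚ.- seq y n ∣ ℚ.< ε

_<_ : ℝ → ℝ → Set
x < y = ∃[ ε ] 0ℚ ℚ.< ε × Eventually λ n → seq x n ℚ.+ ε ℚ.≤ seq y n

private
  ⊔-≤ˡ : ∀ {M N n} → M ℕ.⊔ N ℕ.≤ n → M ℕ.≤ n
  ⊔-≤ˡ {M} {N} = ℕ.m⊔n≤o⇒m≤o M N

  ⊔-≤ʳ : ∀ {M N n} → M ℕ.⊔ N ℕ.≤ n → N ℕ.≤ n
  ⊔-≤ʳ {M} {N} = ℕ.m⊔n≤o⇒n≤o M N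

≃-refl : ∀ {x} → x ≃ x
≃-refl {x} ε ε>0 = 0 , λ n _ →
  subst (λ t → ℚ.∣ t ∣ ℚ.< ε) (sym (ℚ.+-inverseʳ (seq x n))) ε>0

≃-sym : ∀ {x y} → x ≃ y → y ≃ x
≃-sym {x} {y} x≃y ε ε>0 with x≃y ε ε>0
... | N , close = N , λ n N≤n →
  subst (ℚ._< ε) (∣p-q∣-sym (seq x n) (seq y n)) (close n N≤n)

≃-trans : ∀ {x y z} → x ≃ y → y ≃ z → x ≃ z
≃-trans {x} {y} {z} x≃y y≃z ε ε>0 with x≃y (½ ℚ.* ε) (½-pos ε>0) | y≃z (½ ℚ.* ε) (½-pos ε>0)
... | M , p | N , q = M ℕ.⊔ N , λ n le →
  add-< (∣p-r∣-triangle (seq x n) (seq y n) (seq z n)) (p n (⊔-≤ˡ le)) (q n (⊔-≤ʳ le))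

ℝ-setoid : Setoid 0ℓ 0ℓ
ℝ-setoid = record
  { Carrier       = ℝ
  ; _≈_           = _≃_
  ; isEquivalence = record
    { refl  = λ {x} → ≃-refl {x}
    ; sym   = λ {x y} → ≃-sym {x} {y}
    ; trans = λ {x y z} → ≃-trans {x} {y} {z}
    }
  }

fromℚ : ℚ → ℝ
fromℚ q .seq    _ = q
fromℚ q .cauchy ε ε>0 = 0 , λ _ _ _ _ →
  subst (λ t → ℚ.∣ t ∣ ℚ.< ε) (sym (ℚ.+-inverseʳ q)) ε>0

0ℝ 1ℝ : ℝ
0ℝ = fromℚ 0ℚ
1ℝ = fromℚ 1ℚ

infixl 6 _+_ _-_
infixl 7 _*_
infix  8 -_

_+_ : ℝ → ℝ → ℝ
(x + y) .seq n = seq x n ℚ.+ seq y n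
(x + y) .cauchy ε ε>0 with cauchy x (½ ℚ.* ε) (½-pos ε>0) | cauchy y (½ ℚ.* ε) (½-pos ε>0)
... | M , p | N , q = M ℕ.⊔ N , λ m n ≤m ≤n →
  add-< (bound (seq x m) (seq y m) (seq x n) (seq y n))
        (p m n (⊔-≤ˡ ≤m) (⊔-≤ˡ ≤n)) (q m n (⊔-≤ʳ ≤m) (⊔-≤ʳ ≤n))
  where
  bound : ∀ a b c d → ℚ.∣ (a ℚ.+ b) ℚ.- (c ℚ.+ d) ∣ ℚ.≤ ℚ.∣ a ℚ.- c ∣ ℚ.+ ℚ.∣ b ℚ.- d ∣
  bound a b c d = resp-∣∣≤
    (solve 4 (λ a b c d → (a :- c) :+ (b :- d) := (a :+ b) :- (c :+ d)) refl a b c d)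
    (ℚ.∣p+q∣≤∣p∣+∣q∣ (a ℚ.- c) (b ℚ.- d))

-_ : ℝ → ℝ
(- x) .seq n = ℚ.- seq x n
(- x) .cauchy ε ε>0 with cauchy x ε ε>0
... | N , close = N , λ m n ≤m ≤n → subst (ℚ._< ε)
  (trans (∣p-q∣-sym (seq x m) (seq x n)) (cong ℚ.∣_∣
    (solve 2 (λ a b → b :- a := (:- a) :- (:- b)) refl (seq x m) (seq x n))))
  (close m n ≤m ≤n)

_-_ : ℝ → ℝ → ℝ
x - y = x + (- y)

∣_∣ : ℝ → ℝ
∣ x ∣ .seq n = ℚ.∣ seq x n ∣
∣ x ∣ .cauchy ε ε>0 with cauchy x ε ε>0
... | N , close = N , λ m n ≤m ≤n →
  ℚ.≤-<-trans (∣∣p∣-∣q∣∣≤∣p-q∣ (seq x m) (seq x n)) (close m n ≤m ≤n)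

private
  bounded : ∀ x → ∃[ B ] 0ℚ ℚ.< B × Eventually λ n → ℚ.∣ seq x n ∣ ℚ.≤ B
  bounded x with cauchy x 1ℚ (ℚ.positive⁻¹ 1ℚ)
  ... | N , close = ℚ.∣ seq x N ∣ ℚ.+ 1ℚ , ∣p∣+1>0 (seq x N) , N , λ n N≤n →
    ∣p∣-cauchy-bound (close n N N≤n ℕ.≤-refl)

  *-cauchy : ∀ x y → IsCauchy λ n → seq x n ℚ.* seq y n
  *-cauchy x y ε ε>0 =
    let B , B>0 , K , x≤B    = bounded x
        C , C>0 , L , y≤C    = bounded y
        δ , δ>0 , Bδ≡        = split B>0 (½-pos ε>0)
        η , η>0 , Cη≡        = split C>0 (½-pos ε>0)
        M , y-close          = cauchy y δ δ>0
        N , x-close          = cauchy x η η>0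
    in  (K ℕ.⊔ L) ℕ.⊔ (M ℕ.⊔ N) , λ m n ≤m ≤n →
        *-close B>0 C>0 Bδ≡ Cη≡
          (x≤B m (⊔-≤ˡ (⊔-≤ˡ ≤m)))
          (y≤C n (⊔-≤ʳ {K} (⊔-≤ˡ ≤n)))
          (y-close m n (⊔-≤ˡ (⊔-≤ʳ {K ℕ.⊔ L} ≤m)) (⊔-≤ˡ (⊔-≤ʳ {K ℕ.⊔ L} ≤n)))
          (x-close m n (⊔-≤ʳ {M} (⊔-≤ʳ {K ℕ.⊔ L} ≤m)) (⊔-≤ʳ {M} (⊔-≤ʳ {K ℕ.⊔ L} ≤n)))

_*_ : ℝ → ℝ → ℝ
(x * y) .seq n  = seq x n ℚ.* seq y n
(x * y) .cauchy = *-cauchy x y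

inv : (x : ℝ) → 0ℝ < ∣ x ∣ → ℝ
inv x _ .seq n = recip (seq x n)
inv x (c , c>0 , K , away) .cauchy ε ε>0
  with cauchy x ((c ℚ.* c) ℚ.* ε) (*-pos (*-pos c>0 c>0) ε>0)
... | N , close = K ℕ.⊔ N , λ m n ≤m ≤n →
  recip-close c>0 (c≤ m (⊔-≤ˡ ≤m)) (c≤ n (⊔-≤ˡ ≤n)) (close m n (⊔-≤ʳ ≤m) (⊔-≤ʳ ≤n))
  where
  c≤ : ∀ n → K ℕ.≤ n → c ℚ.≤ ℚ.∣ seq x n ∣
  c≤ n K≤n = subst (ℚ._≤ _) (ℚ.+-identityˡ c) (away n K≤n)

_/_! : ℝ → ℕ → ℝ
x / n ! = x * fromℚ ((+ 1 ℚ./ (n !)) {{n ℕ.!≢0}})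

-- The endpoint `nothing` stands for -∞ (lower) or +∞ (upper).
record OpenInterval : Set where
  field
    lower upper : Maybe ℝ

open OpenInterval

infix 4 _∈_

_∈_ : ℝ → OpenInterval → Set
x ∈ I = All (_< x) (lower I) × All (x <_) (upper I)

Point : OpenInterval → Set
Point I = Σ ℝ (_∈ I)

⟪_⟫ : OpenInterval → Setoid 0ℓ 0ℓ
⟪ I ⟫ = On.setoid {B = Point I} ℝ-setoid proj₁

RealFunction : OpenInterval → Set
RealFunction I = Func ⟪ I ⟫ ℝ-setoid

infixr 9 _∘_

_∘_ : ∀ {A B C : Setoid 0ℓ 0ℓ} → Func B C → Func A B → Func A C
g ∘ f = Composition.function f g

-- Regards a function with values in the interval J as a real-valued one.
inclusion : ∀ J → RealFunction J
inclusion J = record { to = proj₁ ; cong = λ eq → eq }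

-- Pointwise limit of the difference quotient as h → 0 with h ≠ 0 (in the form 0 < ∣ h ∣).
IsDerivative : ∀ I → RealFunction I → RealFunction I → Set
IsDerivative I f f′ = ∀ (x : Point I) (ε : ℝ) → 0ℝ < ε →
  ∃[ δ ] 0ℝ < δ ×
    (∀ (h : ℝ) (h≠0 : 0ℝ < ∣ h ∣) → ∣ h ∣ < δ → (x+h∈I : proj₁ x + h ∈ I) →
      ∣ (to f (proj₁ x + h , x+h∈I) - to f x) * inv h h≠0 - to f′ x ∣ < ε)

-- Infinite differentiability, carrying the sequence of all derivatives.
record Smooth (I : OpenInterval) (f : RealFunction I) : Set where
  field
    deriv      : ℕ → RealFunction I
    deriv-zero : ∀ x → to (deriv zero) x ≃ to f x
    deriv-suc  : ∀ n → IsDerivative I (deriv n) (deriv (suc n))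

open Smooth public

PowerSeries : Set
PowerSeries = ℕ → ℝ

infix 4 _≈_

_≈_ : PowerSeries → PowerSeries → Set
A ≈ B = ∀ n → A n ≃ B n

∑≤ : ℕ → (ℕ → ℝ) → ℝ
∑≤ zero    a = a zero
∑≤ (suc n) a = ∑≤ n a + a (suc n)

infixl 7 _⊛_
infixr 8 _^_

_⊛_ : PowerSeries → PowerSeries → PowerSeries
(A ⊛ B) n = ∑≤ n λ k → A k * B (n ℕ.∸ k)

one : PowerSeries
one zero    = 1ℝ
one (suc _) = 0ℝ

_^_ : PowerSeries → ℕ → PowerSeries
A ^ zero  = one
A ^ suc k = A ⊛ A ^ k

-- A(B(z)) = ∑ₖ aₖ B(z)ᵏ.  Since B has zero constant term, zᵏ divides B(z)ᵏ, so the
-- coefficient of zⁿ only receives contributions from k ≤ n.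
substitute : PowerSeries → (B : PowerSeries) → B zero ≃ 0ℝ → PowerSeries
substitute A B _ n = ∑≤ n λ k → A k * (B ^ k) n

taylor : ∀ {I f} → Smooth I f → Point I → PowerSeries
taylor f∞ x n = to (deriv f∞ n) x / n !

-- The same series without its constant term.
taylor₊ : ∀ {I f} → Smooth I f → Point I → PowerSeries
taylor₊ f∞ x zero    = 0ℝ
taylor₊ f∞ x (suc n) = to (deriv f∞ (suc n)) x / suc n !

{-# OPTIONS --safe #-}
module Submission where

-- Write Y = y(x + z) - y(x) and c_n = [zⁿ] ∑ₖ g⁽ᵏ⁾(y(x))/k! Yᵏ.  Since ∂Y/∂x = ∂Y/∂z - y′(x), the
-- product and chain rules give ∂Yᵏ/∂x = ∂Yᵏ/∂z - k y′(x) Yᵏ⁻¹, and the derivative of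
-- g⁽ᵏ⁾(y(x))/k! is (k+1) y′(x) g⁽ᵏ⁺¹⁾(y(x))/(k+1)!.  In the derivative of c_n the terms with y′(x)
-- telescope, leaving c_n′ = (n+1) c_{n+1}.  So the functions n! c_n are successive derivatives,
-- starting with g ∘ y, and derivatives on an open interval are unique.

open import Algebra.Bundles using (CommutativeRing; RawRing)
import Algebra.Construct.Pointwise as Pointwise
import Algebra.Morphism.RingMonomorphism as RingMonomorphism
open import Data.Integer.Base as ℤ using (+_)
import Data.Integer.Tactic.RingSolver as ℤ-Solver
open import Data.Maybe.Base using (Maybe; just; nothing)
open import Data.Maybe.Relation.Unary.All as All using (All; just; nothing)
open import Data.Nat.Base as ℕ using (ℕ; zero; suc; pred; _!; z≤n; s≤s)
import Data.Nat.Properties as ℕ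
open import Data.Product using (∃-syntax; _×_; _,_; proj₁; proj₂)
open import Data.Rational as ℚ using (ℚ; 0ℚ; 1ℚ; ½)
import Data.Rational.Properties as ℚ
import Data.Rational.Unnormalised.Base as ℚᵘ
import Data.Rational.Unnormalised.Properties as ℚᵘ
open import Data.Sum.Base using (_⊎_; inj₁; inj₂; [_,_]′)
open import Function.Bundles using (Func)
open import Level using (0ℓ)
open import Relation.Binary.Bundles using (Setoid)
open import Relation.Binary.Core using (Rel)
import Relation.Binary.PropositionalEquality as ≡
open import Relation.Nullary using (¬_; yes; no; contradiction)

-- The rule for ∂Y/∂x is purely formal: d/dx shifts the Taylor coefficients of y, except that the
-- constant term of Y stays 0 instead of becoming y′(x). So the computation involves no convergence
-- and runs over any commutative ring with a derivation; the ring of functions on I is inserted at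
-- the end. The analysis is constructive, which decides the form of derivative used for the rules. A
-- difference quotient demands an increment apart from 0, but y(x + h) - y(x) may vanish, or may not
-- be known to be apart from 0, so the quotient for g cannot be formed. A bound on the linear
-- remainder avoids the division. It is compared with the difference quotient in both directions,
-- because smoothness is defined by quotients both for y and g and for g ∘ y.

module FormalPowerSeries {c ℓ} (R : CommutativeRing c ℓ) where

  open CommutativeRing R hiding (zero)
  open import Algebra.Properties.Semiring.Mult semiring
    using (×1-homo-*; ×-homo-+) renaming (_×_ to _·_)
  open import Algebra.Solver.Ring.NaturalCoefficients.Default commutativeSemiring
    using (solve; _:+_; _:*_; _:=_; con)
  open import Relation.Binary.Reasoning.Setoid setoid

  infixl 7 _⊛_
  infixr 8 _^_

  ∑ : ℕ → (ℕ → Carrier) → Carrier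
  ∑ zero    a = a zero
  ∑ (suc n) a = ∑ n a + a (suc n)

  _⊛_ : (ℕ → Carrier) → (ℕ → Carrier) → ℕ → Carrier
  (A ⊛ B) n = ∑ n λ k → A k * B (n ℕ.∸ k)

  one : ℕ → Carrier
  one zero    = 1#
  one (suc _) = 0#

  _^_ : (ℕ → Carrier) → ℕ → ℕ → Carrier
  A ^ zero  = one
  A ^ suc k = A ⊛ A ^ k

  compose : (ℕ → Carrier) → (ℕ → Carrier) → ℕ → Carrier
  compose A B n = ∑ n λ k → A k * (B ^ k) n

  ν : ℕ → Carrier
  ν n = n · 1#

  ∂ : (ℕ → Carrier) → ℕ → Carrier
  ∂ A n = ν (suc n) * A (suc n)

  -- Finite sums, Cauchy products and the formal derivative

  ∑-cong : ∀ n {a b} → (∀ k → k ℕ.≤ n → a k ≈ b k) → ∑ n a ≈ ∑ n b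
  ∑-cong zero    a≈b = a≈b 0 z≤n
  ∑-cong (suc n) a≈b =
    +-cong (∑-cong n λ k k≤n → a≈b k (ℕ.m≤n⇒m≤1+n k≤n)) (a≈b (suc n) ℕ.≤-refl)

  ∑-0 : ∀ n {a} → (∀ k → k ℕ.≤ n → a k ≈ 0#) → ∑ n a ≈ 0#
  ∑-0 zero    a≈0 = a≈0 0 z≤n
  ∑-0 (suc n) a≈0 = trans
    (+-cong (∑-0 n λ k k≤n → a≈0 k (ℕ.m≤n⇒m≤1+n k≤n)) (a≈0 (suc n) ℕ.≤-refl))
    (+-identityʳ 0#)

  ∑-+ : ∀ n a b → ∑ n (λ k → a k + b k) ≈ ∑ n a + ∑ n b
  ∑-+ zero    a b = refl
  ∑-+ (suc n) a b = trans (+-congʳ (∑-+ n a b))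
    (solve 4 (λ s t x y → (s :+ t) :+ (x :+ y) := (s :+ x) :+ (t :+ y)) refl
      (∑ n a) (∑ n b) (a (suc n)) (b (suc n)))

  *-∑ : ∀ n c a → c * ∑ n a ≈ ∑ n (λ k → c * a k)
  *-∑ zero    c a = refl
  *-∑ (suc n) c a = trans (distribˡ c (∑ n a) (a (suc n))) (+-congʳ (*-∑ n c a))

  ∑-first : ∀ n a → ∑ (suc n) a ≈ a 0 + ∑ n (λ k → a (suc k))
  ∑-first zero    a = refl
  ∑-first (suc n) a = trans (+-congʳ (∑-first n a)) (+-assoc (a 0) _ _)

  ∑-only-first : ∀ n a → (∀ k → suc k ℕ.≤ n → a (suc k) ≈ 0#) → ∑ n a ≈ a 0
  ∑-only-first zero    a a≈0 = refl
  ∑-only-first (suc n) a a≈0 = begin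
    ∑ (suc n) a                  ≈⟨ ∑-first n a ⟩
    a 0 + ∑ n (λ k → a (suc k))  ≈⟨ +-congˡ (∑-0 n λ k k≤n → a≈0 k (s≤s k≤n)) ⟩
    a 0 + 0#                     ≈⟨ +-identityʳ (a 0) ⟩
    a 0                          ∎

  one-⊛ : ∀ A n → (one ⊛ A) n ≈ A n
  one-⊛ A n = trans (∑-only-first n _ λ _ _ → zeroˡ _) (*-identityˡ (A n))

  ⊛-scale : ∀ A B c n → (A ⊛ λ k → c * B k) n ≈ c * (A ⊛ B) n
  ⊛-scale A B c n = begin
    ∑ n (λ k → A k * (c * B (n ℕ.∸ k)))
      ≈⟨ ∑-cong n (λ k _ → solve 3 (λ a c b → a :* (c :* b) := c :* (a :* b)) refl
                                 (A k) c (B (n ℕ.∸ k))) ⟩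
    ∑ n (λ k → c * (A k * B (n ℕ.∸ k)))  ≈⟨ *-∑ n c _ ⟨
    c * (A ⊛ B) n                        ∎

  -- Writing n + 1 = k + (n + 1 - k) in the k-th term splits the sum in two. The first half vanishes
  -- at k = 0 and the second at k = n + 1, so each becomes a product in degree n.
  ∂-⊛ : ∀ A B n → ∂ (A ⊛ B) n ≈ (∂ A ⊛ B) n + (A ⊛ ∂ B) n
  ∂-⊛ A B n = begin
    ν (suc n) * ∑ (suc n) t
      ≈⟨ *-∑ (suc n) (ν (suc n)) t ⟩
    ∑ (suc n) (λ k → ν (suc n) * t k)
      ≈⟨ ∑-cong (suc n) split ⟩
    ∑ (suc n) (λ k → ν k * t k + ν (suc n ℕ.∸ k) * t k)
      ≈⟨ ∑-+ (suc n) _ _ ⟩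
    ∑ (suc n) (λ k → ν k * t k) + ∑ (suc n) (λ k → ν (suc n ℕ.∸ k) * t k)
      ≈⟨ +-cong left right ⟩
    (∂ A ⊛ B) n + (A ⊛ ∂ B) n ∎
    where
    t : ℕ → Carrier
    t k = A k * B (suc n ℕ.∸ k)

    split : ∀ k → k ℕ.≤ suc n → ν (suc n) * t k ≈ ν k * t k + ν (suc n ℕ.∸ k) * t k
    split k k≤n = begin
      ν (suc n) * t k
        ≡⟨ ≡.cong (λ m → ν m * t k) (ℕ.m+[n∸m]≡n k≤n) ⟨
      ν (k ℕ.+ (suc n ℕ.∸ k)) * t k
        ≈⟨ *-congʳ (×-homo-+ 1# k (suc n ℕ.∸ k)) ⟩
      (ν k + ν (suc n ℕ.∸ k)) * t k
        ≈⟨ distribʳ (t k) _ _ ⟩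
      ν k * t k + ν (suc n ℕ.∸ k) * t k ∎

    left : ∑ (suc n) (λ k → ν k * t k) ≈ (∂ A ⊛ B) n
    left = begin
      ∑ (suc n) (λ k → ν k * t k)
        ≈⟨ ∑-first n _ ⟩
      0# * t 0 + ∑ n (λ k → ν (suc k) * t (suc k))
        ≈⟨ +-congʳ (zeroˡ (t 0)) ⟩
      0# + ∑ n (λ k → ν (suc k) * t (suc k))
        ≈⟨ +-identityˡ _ ⟩
      ∑ n (λ k → ν (suc k) * t (suc k))
        ≈⟨ ∑-cong n (λ k _ → sym (*-assoc (ν (suc k)) (A (suc k)) _)) ⟩
      (∂ A ⊛ B) n ∎

    right : ∑ (suc n) (λ k → ν (suc n ℕ.∸ k) * t k) ≈ (A ⊛ ∂ B) n
    right = begin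
      ∑ n (λ k → ν (suc n ℕ.∸ k) * t k) + ν (n ℕ.∸ n) * t (suc n)
        ≡⟨ ≡.cong (λ m → ∑ n (λ k → ν (suc n ℕ.∸ k) * t k) + ν m * t (suc n)) (ℕ.n∸n≡0 n) ⟩
      ∑ n (λ k → ν (suc n ℕ.∸ k) * t k) + 0# * t (suc n)
        ≈⟨ +-cong (∑-cong n term) (zeroˡ (t (suc n))) ⟩
      (A ⊛ ∂ B) n + 0#
        ≈⟨ +-identityʳ _ ⟩
      (A ⊛ ∂ B) n ∎
      where
      term : ∀ k → k ℕ.≤ n → ν (suc n ℕ.∸ k) * t k ≈ A k * ∂ B (n ℕ.∸ k)
      term k k≤n = begin
        ν (suc n ℕ.∸ k) * (A k * B (suc n ℕ.∸ k))
          ≡⟨ ≡.cong (λ m → ν m * (A k * B m)) (ℕ.+-∸-assoc 1 k≤n) ⟩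
        ν (suc (n ℕ.∸ k)) * (A k * B (suc (n ℕ.∸ k)))
          ≈⟨ solve 3 (λ m a b → m :* (a :* b) := a :* (m :* b)) refl _ (A k) _ ⟩
        A k * ∂ B (n ℕ.∸ k) ∎

  -- Powers of a series without constant term

  module _ {Y : ℕ → Carrier} (Y₀≈0 : Y 0 ≈ 0#) where

    -- Induction on k: a term of the product either contains `Y 0`, or leaves for `Y ^ k` an index
    -- that has dropped below k.
    ^-order : ∀ k m → m ℕ.< k → (Y ^ k) m ≈ 0#
    ^-order (suc k) m (s≤s m≤k) = ∑-0 m term
      where
      term : ∀ j → j ℕ.≤ m → Y j * (Y ^ k) (m ℕ.∸ j) ≈ 0#
      term zero    _   = trans (*-congʳ Y₀≈0) (zeroˡ _)
      term (suc j) j<m = trans (*-congˡ (^-order k (m ℕ.∸ suc j)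
        (ℕ.<-≤-trans (ℕ.∸-monoʳ-< {o = 0} (s≤s z≤n) j<m) m≤k))) (zeroʳ (Y (suc j)))

    -- Only `Y 1` contributes: `Y 0` is 0, and from `Y 2` on the index left for `Y ^ k` is below k.
    -- `D-compose` recognises the boundary term of its telescoping sum by this.
    ^-leading : ∀ k → (Y ^ suc k) (suc k) ≈ Y 1 * (Y ^ k) k
    ^-leading k = begin
      ∑ (suc k) (λ j → Y j * (Y ^ k) (suc k ℕ.∸ j))
        ≈⟨ ∑-first k _ ⟩
      Y 0 * (Y ^ k) (suc k) + ∑ k (λ j → Y (suc j) * (Y ^ k) (k ℕ.∸ j))
        ≈⟨ +-cong (trans (*-congʳ Y₀≈0) (zeroˡ _)) (∑-only-first k _ term) ⟩
      0# + Y 1 * (Y ^ k) k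
        ≈⟨ +-identityˡ _ ⟩
      Y 1 * (Y ^ k) k ∎
      where
      term : ∀ j → suc j ℕ.≤ k → Y (suc (suc j)) * (Y ^ k) (k ℕ.∸ suc j) ≈ 0#
      term j j<k = trans
        (*-congˡ (^-order k (k ℕ.∸ suc j) (ℕ.∸-monoʳ-< {o = 0} (s≤s z≤n) j<k)))
        (zeroʳ _)

  -- Factorials and Taylor coefficients in a ring

  ν-! : ∀ n → ν (suc n !) ≈ ν (suc n) * ν (n !)
  ν-! n = ×1-homo-* (suc n) (n !)

  -- The factors c n play the role of 1/n!.
  taylor : (ℕ → Carrier) → (ℕ → Carrier) → ℕ → Carrier
  taylor c a n = a n * c n

  taylor₊ : (ℕ → Carrier) → (ℕ → Carrier) → ℕ → Carrier
  taylor₊ c a zero    = 0#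
  taylor₊ c a (suc n) = a (suc n) * c (suc n)

  module _ {c : ℕ → Carrier} (c₀≈1 : c 0 ≈ 1#) (c-suc : ∀ n → ν (suc n) * c (suc n) ≈ c n) where

    c₁≈1 : c 1 ≈ 1#
    c₁≈1 = begin
      c 1        ≈⟨ solve 1 (λ x → x := (con 1 :+ con 0) :* x) refl (c 1) ⟩
      ν 1 * c 1  ≈⟨ c-suc 0 ⟩
      c 0        ≈⟨ c₀≈1 ⟩
      1#         ∎

    ν!*c≈1 : ∀ n → ν (n !) * c n ≈ 1#
    ν!*c≈1 zero    = trans (solve 1 (λ x → (con 1 :+ con 0) :* x := x) refl (c 0)) c₀≈1
    ν!*c≈1 (suc n) = begin
      ν (suc n !) * c (suc n)             ≈⟨ *-congʳ (ν-! n) ⟩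
      (ν (suc n) * ν (n !)) * c (suc n)   ≈⟨ solve 3 (λ a b x → (a :* b) :* x := b :* (a :* x)) refl
                                               (ν (suc n)) (ν (n !)) (c (suc n)) ⟩
      ν (n !) * (ν (suc n) * c (suc n))   ≈⟨ *-congˡ (c-suc n) ⟩
      ν (n !) * c n                       ≈⟨ ν!*c≈1 n ⟩
      1#                                  ∎

  -- Derivations and the coefficients of a composite series

  -- A relation rather than an operation, since not every element need have a derivative.
  record IsDerivation {d} (D : Rel Carrier d) : Set (c Level.⊔ ℓ Level.⊔ d) where
    field
      D-resp : ∀ {a b a′ b′} → a ≈ b → a′ ≈ b′ → D a a′ → D b b′
      D-0    : D 0# 0#
      D-1    : D 1# 0#
      D-+    : ∀ {a b a′ b′} → D a a′ → D b b′ → D (a + b) (a′ + b′)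
      D-*    : ∀ {a b a′ b′} → D a a′ → D b b′ → D (a * b) (a′ * b + a * b′)

    D-∑ : ∀ n {a a′} → (∀ k → D (a k) (a′ k)) → D (∑ n a) (∑ n a′)
    D-∑ zero    Da = Da 0
    D-∑ (suc n) Da = D-+ (D-∑ n Da) (Da (suc n))

    D-ν : ∀ n → D (ν n) 0#
    D-ν zero    = D-0
    D-ν (suc n) = D-resp refl (+-identityʳ 0#) (D-+ D-1 (D-ν n))

    D-scale : ∀ {k a a′} → D k 0# → D a a′ → D (k * a) (k * a′)
    D-scale {k} {a} {a′} Dk Da = D-resp refl
      (trans (+-congʳ (zeroˡ a)) (+-identityˡ (k * a′))) (D-* Dk Da)

    -- `DY` leaves out degree 0: the constant coefficient is 0 and has derivative 0, whereas `∂ Y 0`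
    -- equals `Y 1`, which stands for y′(x). This one discrepancy is the source of all correction
    -- terms.
    module _ {Y G : ℕ → Carrier} (Y₀≈0 : Y 0 ≈ 0#)
             (DY : ∀ n → D (Y (suc n)) (∂ Y (suc n)))
             (DG : ∀ k → D (G k) (∂ G k * Y 1)) where

      private
        -- At k = 0 the truncated exponent is harmless, as ν 0 = 0.
        correction : ℕ → ℕ → Carrier
        correction k n = (ν k * Y 1) * (Y ^ pred k) n

        x-y+y : ∀ x y → (x - y) + y ≈ x
        x-y+y x y = trans (+-assoc x (- y) y)
          (trans (+-congˡ (-‿inverseˡ y)) (+-identityʳ x))

        -- The solver in use knows only semiring operations, so identities with a difference are
        -- proved with the subtracted term moved across and then converted.
        +⇒- : ∀ {x y z} → x + y ≈ z → x ≈ z - y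
        +⇒- {x} {y} {z} x+y≈z = begin
          x            ≈⟨ +-identityʳ x ⟨
          x + 0#       ≈⟨ +-congˡ (-‿inverseʳ y) ⟨
          x + (y - y)  ≈⟨ +-assoc x y (- y) ⟨
          x + y - y    ≈⟨ +-congʳ x+y≈z ⟩
          z - y        ∎

        -- One formula for all degrees: `one j` removes `Y 1` in degree 0, where `∂ Y 0` is wrong by
        -- exactly that amount, and nothing elsewhere.
        Y-correction : ∀ j → D (Y j) (∂ Y j - Y 1 * one j)
        Y-correction zero    = D-resp (sym Y₀≈0)
          (+⇒- (solve 1 (λ y → con 0 :+ y :* con 1 := (con 1 :+ con 0) :* y) refl (Y 1))) D-0
        Y-correction (suc j) = D-resp refl
          (+⇒- (trans (+-congˡ (zeroʳ (Y 1))) (+-identityʳ _))) (DY j)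

        -- The product rule for Y · Yᵏ yields y′ Yᵏ from the first factor and Y · k y′ Yᵏ⁻¹ from the
        -- second, together (k + 1) y′ Yᵏ. The case split lets `pred` compute.
        Y⊛correction : ∀ k n → Y 1 * (Y ^ k) n + (Y ⊛ correction k) n ≈ correction (suc k) n
        Y⊛correction zero    n = begin
          Y 1 * one n + (Y ⊛ correction 0) n
            ≈⟨ +-congˡ (⊛-scale Y one (0# * Y 1) n) ⟩
          Y 1 * one n + (0# * Y 1) * (Y ⊛ one) n
            ≈⟨ solve 3 (λ y p q → y :* p :+ (con 0 :* y) :* q := ((con 1 :+ con 0) :* y) :* p)
                 refl (Y 1) (one n) ((Y ⊛ one) n) ⟩
          correction 1 n ∎
        Y⊛correction (suc k) n = begin
          Y 1 * (Y ^ suc k) n + (Y ⊛ correction (suc k)) n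
            ≈⟨ +-congˡ (⊛-scale Y (Y ^ k) (ν (suc k) * Y 1) n) ⟩
          Y 1 * (Y ^ suc k) n + (ν (suc k) * Y 1) * (Y ^ suc k) n
            ≈⟨ solve 3 (λ m y p → y :* p :+ (m :* y) :* p := ((con 1 :+ m) :* y) :* p)
                 refl (ν (suc k)) (Y 1) ((Y ^ suc k) n) ⟩
          correction (suc (suc k)) n ∎

        -- Induction on k: the product rule for `D` and the Leibniz rule `∂-⊛` expand Yᵏ⁺¹ over the
        -- same convolution, so only the corrections remain to be compared.
        D-^ : ∀ k n → D ((Y ^ k) n) (∂ (Y ^ k) n - correction k n)
        D-^ zero    n = D-resp refl (+⇒- 0+corr) (D-one n)
          where
          D-one : ∀ n → D (one n) 0#
          D-one zero    = D-1
          D-one (suc n) = D-0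
          0+corr : 0# + correction 0 n ≈ ∂ one n
          0+corr = solve 3 (λ y p m → con 0 :+ (con 0 :* y) :* p := m :* con 0) refl
            (Y 1) (one n) (ν (suc n))
        D-^ (suc k) n = D-resp refl (+⇒- collect)
          (D-∑ n λ j → D-* (Y-correction j) (D-^ k (n ℕ.∸ j)))
          where
          P : ℕ → Carrier
          P = Y ^ k

          u v : ℕ → Carrier
          u j = ∂ Y j - Y 1 * one j
          v j = ∂ P j - correction k j

          collect : ∑ n (λ j → u j * P (n ℕ.∸ j) + Y j * v (n ℕ.∸ j)) + correction (suc k) n ≈
                    ∂ (Y ⊛ P) n
          collect = begin
            ∑ n (λ j → u j * P (n ℕ.∸ j) + Y j * v (n ℕ.∸ j)) + correction (suc k) n
              -- The correction is spread out as convolutions with the smaller power, so that it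
              -- merges with the sum and cancels term by term.
              ≈⟨ +-congˡ (trans (+-congʳ (*-congˡ (one-⊛ P n))) (Y⊛correction k n)) ⟨
            ∑ n (λ j → u j * P (n ℕ.∸ j) + Y j * v (n ℕ.∸ j)) +
              (Y 1 * (one ⊛ P) n + (Y ⊛ correction k) n)
              ≈⟨ +-congˡ (+-congʳ (*-∑ n (Y 1) _)) ⟩
            ∑ n (λ j → u j * P (n ℕ.∸ j) + Y j * v (n ℕ.∸ j)) +
              (∑ n (λ j → Y 1 * (one j * P (n ℕ.∸ j))) + (Y ⊛ correction k) n)
              ≈⟨ +-congˡ (∑-+ n _ _) ⟨
            ∑ n (λ j → u j * P (n ℕ.∸ j) + Y j * v (n ℕ.∸ j)) +
              ∑ n (λ j → Y 1 * (one j * P (n ℕ.∸ j)) + Y j * correction k (n ℕ.∸ j))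
              ≈⟨ ∑-+ n _ _ ⟨
            ∑ n (λ j → (u j * P (n ℕ.∸ j) + Y j * v (n ℕ.∸ j)) +
                       (Y 1 * (one j * P (n ℕ.∸ j)) + Y j * correction k (n ℕ.∸ j)))
              ≈⟨ ∑-cong n (λ j _ → term j (n ℕ.∸ j)) ⟩
            ∑ n (λ j → ∂ Y j * P (n ℕ.∸ j) + Y j * ∂ P (n ℕ.∸ j))
              ≈⟨ ∑-+ n _ _ ⟩
            (∂ Y ⊛ P) n + (Y ⊛ ∂ P) n
              ≈⟨ ∂-⊛ Y P n ⟨
            ∂ (Y ⊛ P) n ∎
            where
            term : ∀ j i → (u j * P i + Y j * v i) + (Y 1 * (one j * P i) + Y j * correction k i) ≈
                           ∂ Y j * P i + Y j * ∂ P i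
            term j i = begin
              (u j * P i + Y j * v i) + (Y 1 * (one j * P i) + Y j * correction k i)
                ≈⟨ solve 7 (λ u p y v y₁ o w → (u :* p :+ y :* v) :+ (y₁ :* (o :* p) :+ y :* w) :=
                                              (u :+ y₁ :* o) :* p :+ y :* (v :+ w)) refl
                     (u j) (P i) (Y j) (v i) (Y 1) (one j) (correction k i) ⟩
              (u j + Y 1 * one j) * P i + Y j * (v i + correction k i)
                ≈⟨ +-cong (*-congʳ (x-y+y _ _)) (*-congˡ (x-y+y _ _)) ⟩
              ∂ Y j * P i + Y j * ∂ P i ∎

      -- The truncation of the sums matters here. Differentiating the coefficient in degree n
      -- involves only k ≤ n, while the coefficient in degree n + 1 also has a summand k = n + 1.
      -- The shift of k leaves over exactly `T (suc n)`, which by `^-leading` is the missing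
      -- summand; at the other end `T 0` is 0.
      D-compose : ∀ n → D (compose G Y n) (∂ (compose G Y) n)
      D-compose n = D-resp refl telescope (D-∑ n λ k → D-* (DG k) (D-^ k n))
        where
        T Q : ℕ → Carrier
        T k = G k * correction k n
        Q k = ∂ (Y ^ k) n - correction k n

        T-suc : ∀ k → (∂ G k * Y 1) * (Y ^ k) n ≈ T (suc k)
        T-suc k = solve 4 (λ m g y p → ((m :* g) :* y) :* p := g :* ((m :* y) :* p)) refl
          (ν (suc k)) (G (suc k)) (Y 1) ((Y ^ k) n)

        T-0 : T 0 ≈ 0#
        T-0 = solve 3 (λ g y p → g :* ((con 0 :* y) :* p) := con 0) refl (G 0) (Y 1) (one n)

        T-last : T (suc n) ≈ ν (suc n) * (G (suc n) * (Y ^ suc n) (suc n))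
        T-last = begin
          G (suc n) * ((ν (suc n) * Y 1) * (Y ^ n) n)
            ≈⟨ solve 4 (λ g m y p → g :* ((m :* y) :* p) := m :* (g :* (y :* p))) refl
                 (G (suc n)) (ν (suc n)) (Y 1) ((Y ^ n) n) ⟩
          ν (suc n) * (G (suc n) * (Y 1 * (Y ^ n) n))
            ≈⟨ *-congˡ (*-congˡ (^-leading Y₀≈0 n)) ⟨
          ν (suc n) * (G (suc n) * (Y ^ suc n) (suc n)) ∎

        shifted : ∑ n (λ k → T (suc k)) ≈ ∑ n T + T (suc n)
        shifted = begin
          ∑ n (λ k → T (suc k))        ≈⟨ +-identityˡ _ ⟨
          0# + ∑ n (λ k → T (suc k))   ≈⟨ +-congʳ T-0 ⟨
          T 0 + ∑ n (λ k → T (suc k))  ≈⟨ ∑-first n T ⟨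
          ∑ n T + T (suc n)            ∎

        restored : ∑ n T + ∑ n (λ k → G k * Q k) ≈
                   ν (suc n) * ∑ n (λ k → G k * (Y ^ k) (suc n))
        restored = begin
          ∑ n T + ∑ n (λ k → G k * Q k)
            ≈⟨ ∑-+ n _ _ ⟨
          ∑ n (λ k → T k + G k * Q k)
            ≈⟨ ∑-cong n (λ k _ → term k) ⟩
          ∑ n (λ k → ν (suc n) * (G k * (Y ^ k) (suc n)))
            ≈⟨ *-∑ n (ν (suc n)) _ ⟨
          ν (suc n) * ∑ n (λ k → G k * (Y ^ k) (suc n)) ∎
          where
          term : ∀ k → T k + G k * Q k ≈ ν (suc n) * (G k * (Y ^ k) (suc n))
          term k = begin
            G k * correction k n + G k * Q k
              ≈⟨ solve 3 (λ g w q → g :* w :+ g :* q := g :* (q :+ w)) refl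
                   (G k) (correction k n) (Q k) ⟩
            G k * (Q k + correction k n)
              ≈⟨ *-congˡ (x-y+y _ _) ⟩
            G k * (ν (suc n) * (Y ^ k) (suc n))
              ≈⟨ solve 3 (λ g m p → g :* (m :* p) := m :* (g :* p)) refl (G k) (ν (suc n)) _ ⟩
            ν (suc n) * (G k * (Y ^ k) (suc n)) ∎

        telescope : ∑ n (λ k → (∂ G k * Y 1) * (Y ^ k) n + G k * Q k) ≈ ∂ (compose G Y) n
        telescope = begin
          ∑ n (λ k → (∂ G k * Y 1) * (Y ^ k) n + G k * Q k)
            ≈⟨ ∑-+ n _ _ ⟩
          ∑ n (λ k → (∂ G k * Y 1) * (Y ^ k) n) + ∑ n (λ k → G k * Q k)
            ≈⟨ +-congʳ (trans (∑-cong n λ k _ → T-suc k) shifted) ⟩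
          (∑ n T + T (suc n)) + ∑ n (λ k → G k * Q k)
            ≈⟨ solve 3 (λ s t q → (s :+ t) :+ q := (s :+ q) :+ t) refl
                 (∑ n T) (T (suc n)) (∑ n (λ k → G k * Q k)) ⟩
          (∑ n T + ∑ n (λ k → G k * Q k)) + T (suc n)
            ≈⟨ +-cong restored T-last ⟩
          ν (suc n) * ∑ n (λ k → G k * (Y ^ k) (suc n)) +
            ν (suc n) * (G (suc n) * (Y ^ suc n) (suc n))
            ≈⟨ distribˡ (ν (suc n)) _ _ ⟨
          ν (suc n) * compose G Y (suc n) ∎

    -- If g n and y n are the n-th derivatives of functions g and y, the former evaluated at
    -- y, then chain n is the n-th derivative of the composite.
    module Chain {c g y : ℕ → Carrier} (c₀≈1 : c 0 ≈ 1#)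
                 (c-suc : ∀ n → ν (suc n) * c (suc n) ≈ c n) (Dc : ∀ n → D (c n) 0#)
                 (Dy : ∀ n → D (y (suc n)) (y (suc (suc n))))
                 (Dg : ∀ n → D (g n) (g (suc n) * y 1)) where

      series : ℕ → Carrier
      series = compose (taylor c g) (taylor₊ c y)

      chain : ℕ → Carrier
      chain n = ν (n !) * series n

      private
        -- Writing 1/n! as (n + 1)/(n + 1)! brings the derivative of a Taylor coefficient into the
        -- shape of `∂`.
        D-divide : ∀ n {a b} → D a b → D (a * c n) (ν (suc n) * (b * c (suc n)))
        D-divide n {a} {b} Da = D-resp refl eq (D-* Da (Dc n))
          where
          eq : b * c n + a * 0# ≈ ν (suc n) * (b * c (suc n))
          eq = begin
            b * c n + a * 0#
              ≈⟨ +-cong (*-congˡ (sym (c-suc n))) (zeroʳ a) ⟩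
            b * (ν (suc n) * c (suc n)) + 0#
              ≈⟨ solve 3 (λ b m x → b :* (m :* x) :+ con 0 := m :* (b :* x)) refl
                   b (ν (suc n)) (c (suc n)) ⟩
            ν (suc n) * (b * c (suc n)) ∎

        D-taylor : ∀ k → D (taylor c g k) (∂ (taylor c g) k * taylor₊ c y 1)
        D-taylor k = D-resp refl eq (D-divide k (Dg k))
          where
          eq : ν (suc k) * ((g (suc k) * y 1) * c (suc k)) ≈
               (ν (suc k) * (g (suc k) * c (suc k))) * (y 1 * c 1)
          eq = begin
            ν (suc k) * ((g (suc k) * y 1) * c (suc k))
              ≈⟨ solve 4 (λ m g y x → m :* ((g :* y) :* x) := (m :* (g :* x)) :* (y :* con 1))
                   refl (ν (suc k)) (g (suc k)) (y 1) (c (suc k)) ⟩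
            (ν (suc k) * (g (suc k) * c (suc k))) * (y 1 * 1#)
              ≈⟨ *-congˡ (*-congˡ (c₁≈1 c₀≈1 c-suc)) ⟨
            (ν (suc k) * (g (suc k) * c (suc k))) * (y 1 * c 1) ∎

      D-chain : ∀ n → D (chain n) (chain (suc n))
      D-chain n = D-resp refl eq
        (D-scale (D-ν (n !)) (D-compose refl (λ n → D-divide (suc n) (Dy n)) D-taylor n))
        where
        eq : ν (n !) * (ν (suc n) * series (suc n)) ≈ chain (suc n)
        eq = begin
          ν (n !) * (ν (suc n) * series (suc n))
            ≈⟨ solve 3 (λ a b x → a :* (b :* x) := (b :* a) :* x) refl
                 (ν (n !)) (ν (suc n)) (series (suc n)) ⟩
          (ν (suc n) * ν (n !)) * series (suc n)
            ≈⟨ *-congʳ (ν-! n) ⟨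
          chain (suc n) ∎

      chain-0 : chain 0 ≈ g 0
      chain-0 = begin
        ν 1 * ((g 0 * c 0) * 1#)
          ≈⟨ *-congˡ (*-congʳ (*-congˡ c₀≈1)) ⟩
        ν 1 * ((g 0 * 1#) * 1#)
          ≈⟨ trans (*-congʳ (+-identityʳ 1#)) (*-identityˡ _) ⟩
        (g 0 * 1#) * 1#
          ≈⟨ trans (*-identityʳ _) (*-identityʳ _) ⟩
        g 0 ∎

      taylor-chain : ∀ {f} → (∀ n → f n ≈ chain n) → ∀ n → taylor c f n ≈ series n
      taylor-chain {f} f≈chain n = begin
        f n * c n
          ≈⟨ *-congʳ (f≈chain n) ⟩
        (ν (n !) * series n) * c n
          ≈⟨ solve 3 (λ m s x → (m :* s) :* x := (m :* x) :* s) refl (ν (n !)) (series n) (c n) ⟩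
        (ν (n !) * c n) * series n
          ≈⟨ *-congʳ (ν!*c≈1 c₀≈1 c-suc n) ⟩
        1# * series n
          ≈⟨ *-identityˡ _ ⟩
        series n ∎

open import Data.Rational.Solver using (module +-*-Solver)
open import Defs
open import Relation.Binary.PropositionalEquality
  using (_≡_; refl; sym; trans; cong; cong₂; subst; subst₂)

open Func using (to)
open OpenInterval
open +-*-Solver using (solve; _:+_; _:*_; _:-_; :-_; _:=_; con)

-- Arithmetic of rationals

fromℚᵘ-homo-+ : ∀ p q → ℚ.fromℚᵘ p ℚ.+ ℚ.fromℚᵘ q ≡ ℚ.fromℚᵘ (p ℚᵘ.+ q)
fromℚᵘ-homo-+ p q = ℚ.toℚᵘ-injective (begin
  ℚ.toℚᵘ (ℚ.fromℚᵘ p ℚ.+ ℚ.fromℚᵘ q)                ≈⟨ ℚ.toℚᵘ-homo-+ (ℚ.fromℚᵘ p) (ℚ.fromℚᵘ q) ⟩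
  ℚ.toℚᵘ (ℚ.fromℚᵘ p) ℚᵘ.+ ℚ.toℚᵘ (ℚ.fromℚᵘ q)      ≈⟨ ℚᵘ.+-cong (ℚ.toℚᵘ-fromℚᵘ p) (ℚ.toℚᵘ-fromℚᵘ q) ⟩
  p ℚᵘ.+ q                                          ≈⟨ ℚ.toℚᵘ-fromℚᵘ (p ℚᵘ.+ q) ⟨
  ℚ.toℚᵘ (ℚ.fromℚᵘ (p ℚᵘ.+ q))                      ∎)
  where open import Relation.Binary.Reasoning.Setoid ℚᵘ.≃-setoid

fromℚᵘ-homo-* : ∀ p q → ℚ.fromℚᵘ p ℚ.* ℚ.fromℚᵘ q ≡ ℚ.fromℚᵘ (p ℚᵘ.* q)
fromℚᵘ-homo-* p q = ℚ.toℚᵘ-injective (begin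
  ℚ.toℚᵘ (ℚ.fromℚᵘ p ℚ.* ℚ.fromℚᵘ q)                ≈⟨ ℚ.toℚᵘ-homo-* (ℚ.fromℚᵘ p) (ℚ.fromℚᵘ q) ⟩
  ℚ.toℚᵘ (ℚ.fromℚᵘ p) ℚᵘ.* ℚ.toℚᵘ (ℚ.fromℚᵘ q)      ≈⟨ ℚᵘ.*-cong (ℚ.toℚᵘ-fromℚᵘ p) (ℚ.toℚᵘ-fromℚᵘ q) ⟩
  p ℚᵘ.* q                                          ≈⟨ ℚ.toℚᵘ-fromℚᵘ (p ℚᵘ.* q) ⟨
  ℚ.toℚᵘ (ℚ.fromℚᵘ (p ℚᵘ.* q))                      ∎)
  where open import Relation.Binary.Reasoning.Setoid ℚᵘ.≃-setoid

-- Normalising a fraction takes a gcd, which is stuck on a variable. On unnormalised fractions the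
-- claim is an identity of integers.
1+n/1 : ∀ n → 1ℚ ℚ.+ + n ℚ./ 1 ≡ + suc n ℚ./ 1
1+n/1 n = trans (fromℚᵘ-homo-+ ℚᵘ.1ℚᵘ (ℚᵘ.mkℚᵘ (+ n) 0))
  (ℚ.fromℚᵘ-cong {ℚᵘ.1ℚᵘ ℚᵘ.+ ℚᵘ.mkℚᵘ (+ n) 0} {ℚᵘ.mkℚᵘ (+ suc n) 0} (ℚᵘ.*≡* (lemma (+ n))))
  where
  lemma : ∀ i → (+ 1 ℤ.* + 1 ℤ.+ i ℤ.* + 1) ℤ.* + 1 ≡ (+ 1 ℤ.+ i) ℤ.* + 1
  lemma = ℤ-Solver.solve-∀

m*1/md : ∀ m d .{{_ : ℕ.NonZero d}} .{{_ : ℕ.NonZero (suc m ℕ.* d)}} →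
         (+ suc m ℚ./ 1) ℚ.* (+ 1 ℚ./ (suc m ℕ.* d)) ≡ + 1 ℚ./ d
m*1/md m d@(suc _) = trans (fromℚᵘ-homo-* p q)
  (ℚ.fromℚᵘ-cong {p ℚᵘ.* q} {ℚᵘ.mkℚᵘ (+ 1) (pred d)} (ℚᵘ.*≡* (lemma (+ suc m) (+ d))))
  where
  p q : ℚᵘ.ℚᵘ
  p = ℚᵘ.mkℚᵘ (+ suc m) 0
  q = ℚᵘ.mkℚᵘ (+ 1) (pred (suc m ℕ.* d))

  lemma : ∀ i j → (i ℤ.* + 1) ℤ.* j ≡ + 1 ℤ.* (+ 1 ℤ.* (i ℤ.* j))
  lemma = ℤ-Solver.solve-∀

½-pos : ∀ {ε} → 0ℚ ℚ.< ε → 0ℚ ℚ.< ½ ℚ.* ε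
½-pos = ℚ.*-monoʳ-<-pos ½

½+½ : ∀ ε → ½ ℚ.* ε ℚ.+ ½ ℚ.* ε ≡ ε
½+½ ε = trans (sym (ℚ.*-distribʳ-+ ε ½ ½)) (ℚ.*-identityˡ ε)

½-< : ∀ {ε} → 0ℚ ℚ.< ε → ½ ℚ.* ε ℚ.< ε
½-< {ε} ε>0 = subst₂ ℚ._<_ (ℚ.+-identityʳ (½ ℚ.* ε)) (½+½ ε)
  (ℚ.+-monoʳ-< (½ ℚ.* ε) (½-pos ε>0))

+-pos : ∀ {p q} → 0ℚ ℚ.< p → 0ℚ ℚ.< q → 0ℚ ℚ.< p ℚ.+ q
+-pos = ℚ.+-mono-<

*-pos : ∀ {p q} → 0ℚ ℚ.< p → 0ℚ ℚ.< q → 0ℚ ℚ.< p ℚ.* q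
*-pos {p} {q} p>0 q>0 = ℚ.positive⁻¹ (p ℚ.* q)
  {{ℚ.pos*pos⇒pos p {{ℚ.positive p>0}} q {{ℚ.positive q>0}}}}

*-monoʳ-≤ : ∀ {p q r} → 0ℚ ℚ.≤ r → p ℚ.≤ q → r ℚ.* p ℚ.≤ r ℚ.* q
*-monoʳ-≤ {r = r} r≥0 = ℚ.*-monoˡ-≤-nonNeg r {{ℚ.nonNegative r≥0}}

*-monoˡ-≤ : ∀ {p q r} → 0ℚ ℚ.≤ r → p ℚ.≤ q → p ℚ.* r ℚ.≤ q ℚ.* r
*-monoˡ-≤ {r = r} r≥0 = ℚ.*-monoʳ-≤-nonNeg r {{ℚ.nonNegative r≥0}}

p<q⇒0<q-p : ∀ {p q} → p ℚ.< q → 0ℚ ℚ.< q ℚ.- p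
p<q⇒0<q-p {p} {q} p<q = subst (ℚ._< q ℚ.- p) (ℚ.+-inverseʳ p) (ℚ.+-monoˡ-< (ℚ.- p) p<q)

p+[q-p]≡q : ∀ p q → p ℚ.+ (q ℚ.- p) ≡ q
p+[q-p]≡q = solve 2 (λ p q → p :+ (q :- p) := q) refl

p≤p+q : ∀ p {q} → 0ℚ ℚ.≤ q → p ℚ.≤ p ℚ.+ q
p≤p+q p {q} q≥0 = subst (ℚ._≤ p ℚ.+ q) (ℚ.+-identityʳ p) (ℚ.+-monoʳ-≤ p q≥0)

common-lower-bound : ∀ {p q} → 0ℚ ℚ.< p → 0ℚ ℚ.< q →
                     ∃[ r ] 0ℚ ℚ.< r × r ℚ.≤ p × r ℚ.≤ q
common-lower-bound {p} {q} p>0 q>0 with ℚ.≤-total p q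
... | inj₁ p≤q = p , p>0 , ℚ.≤-refl , p≤q
... | inj₂ q≤p = q , q>0 , q≤p , ℚ.≤-refl

quotient-pos : ∀ {B ε} → 0ℚ ℚ.< B → 0ℚ ℚ.< ε → ∃[ δ ] 0ℚ ℚ.< δ × B ℚ.* δ ≡ ε
quotient-pos {B} {ε} B>0 ε>0 =
  B⁻¹ ℚ.* ε , *-pos (ℚ.positive⁻¹ B⁻¹ {{ℚ.1/pos⇒pos B}}) ε>0 ,
  trans (sym (ℚ.*-assoc B B⁻¹ ε))
    (trans (cong (ℚ._* ε) (ℚ.*-inverseʳ B {{ℚ.pos⇒nonZero B}})) (ℚ.*-identityˡ ε))
  where
  instance _ = ℚ.positive B>0
  B⁻¹ = (ℚ.1/ B) {{ℚ.pos⇒nonZero B}}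

p≤∣p∣ : ∀ p → p ℚ.≤ ℚ.∣ p ∣
p≤∣p∣ p with ℚ.≤-total 0ℚ p
... | inj₁ 0≤p = ℚ.≤-reflexive (sym (ℚ.0≤p⇒∣p∣≡p 0≤p))
... | inj₂ p≤0 = ℚ.≤-trans p≤0 (ℚ.0≤∣p∣ p)

∣p∣≤∣q∣+∣p-q∣ : ∀ p q → ℚ.∣ p ∣ ℚ.≤ ℚ.∣ q ∣ ℚ.+ ℚ.∣ p ℚ.- q ∣
∣p∣≤∣q∣+∣p-q∣ p q = subst (λ t → ℚ.∣ t ∣ ℚ.≤ ℚ.∣ q ∣ ℚ.+ ℚ.∣ p ℚ.- q ∣) (p+[q-p]≡q q p)
  (ℚ.∣p+q∣≤∣p∣+∣q∣ q (p ℚ.- q))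

*-recip : ∀ {p} → 0ℚ ℚ.< ℚ.∣ p ∣ → p ℚ.* recip p ≡ 1ℚ
*-recip {p} p≠0 with p ℚ.≟ 0ℚ
... | yes refl = contradiction p≠0 (ℚ.<-irrefl refl)
... | no  p≢0  = ℚ.*-inverseʳ p {{ℚ.≢-nonZero p≢0}}

-- This links the two notions of derivative: times h, the error of a difference quotient is the
-- linear remainder.
quotient-remainder : ∀ a d {h} → 0ℚ ℚ.< ℚ.∣ h ∣ →
                     (a ℚ.* recip h ℚ.- d) ℚ.* h ≡ a ℚ.- d ℚ.* h
quotient-remainder a d {h} h≠0 = trans
  (solve 4 (λ a d h i → (a :* i :- d) :* h := a :* (h :* i) :- d :* h) refl a d h (recip h))
  (cong (ℚ._- d ℚ.* h) (trans (cong (a ℚ.*_) (*-recip h≠0)) (ℚ.*-identityʳ a)))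

-- Eventual rational bounds on reals

map-eventually : ∀ {P Q : ℕ → Set} → (∀ n → P n → Q n) → Eventually P → Eventually Q
map-eventually f (N , p) = N , λ n N≤n → f n (p n N≤n)

zip-eventually : ∀ {P Q R : ℕ → Set} → (∀ n → P n → Q n → R n) →
                 Eventually P → Eventually Q → Eventually R
zip-eventually f (M , p) (N , q) = M ℕ.⊔ N , λ n le →
  f n (p n (ℕ.m⊔n≤o⇒m≤o M N le)) (q n (ℕ.m⊔n≤o⇒n≤o M N le))

infix 4 _⊑_

-- A bound on the representing sequence, hence not invariant under _≃_; ⊑-resp recovers
-- invariance up to an arbitrarily small loss.
record _⊑_ (x : ℝ) (q : ℚ) : Set where
  constructor ⊑-intro
  field
    ⊑-elim : Eventually λ n → ℚ.∣ seq x n ∣ ℚ.≤ q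

open _⊑_

⊑-≡ : ∀ {x y q} → (∀ n → seq x n ≡ seq y n) → x ⊑ q → y ⊑ q
⊑-≡ {q = q} x≡y (⊑-intro x⊑q) =
  ⊑-intro (map-eventually (λ n → subst (λ t → ℚ.∣ t ∣ ℚ.≤ q) (x≡y n)) x⊑q)

⊑-weaken : ∀ {x p q} → p ℚ.≤ q → x ⊑ p → x ⊑ q
⊑-weaken p≤q (⊑-intro x⊑p) = ⊑-intro (map-eventually (λ n x≤p → ℚ.≤-trans x≤p p≤q) x⊑p)

⊑-cast : ∀ {x y p q} → x ⊑ p → p ≡ q → (∀ n → seq x n ≡ seq y n) → y ⊑ q
⊑-cast x⊑p refl x≡y = ⊑-≡ x≡y x⊑p

⊑-const : ∀ {x} q → (∀ n → seq x n ≡ q) → x ⊑ ℚ.∣ q ∣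
⊑-const q x≡q = ⊑-intro (0 , λ n _ → ℚ.≤-reflexive (cong ℚ.∣_∣ (x≡q n)))

⊑-+ : ∀ {x y p q} → x ⊑ p → y ⊑ q → x + y ⊑ p ℚ.+ q
⊑-+ {x} {y} (⊑-intro x⊑p) (⊑-intro y⊑q) = ⊑-intro (zip-eventually
  (λ n x≤p y≤q → ℚ.≤-trans (ℚ.∣p+q∣≤∣p∣+∣q∣ (seq x n) (seq y n)) (ℚ.+-mono-≤ x≤p y≤q))
  x⊑p y⊑q)

⊑-neg : ∀ {x q} → x ⊑ q → - x ⊑ q
⊑-neg {x} {q} (⊑-intro x⊑q) = ⊑-intro (map-eventually
  (λ n → subst (ℚ._≤ q) (sym (ℚ.∣-p∣≡∣p∣ (seq x n)))) x⊑q)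

⊑-* : ∀ {x y p q} → x ⊑ p → y ⊑ q → x * y ⊑ p ℚ.* q
⊑-* {x} {y} {p} {q} (⊑-intro x⊑p) (⊑-intro y⊑q) = ⊑-intro (zip-eventually
  (λ n x≤p y≤q → subst (ℚ._≤ p ℚ.* q) (sym (ℚ.∣p*q∣≡∣p∣*∣q∣ (seq x n) (seq y n)))
    (ℚ.≤-trans (*-monoˡ-≤ (ℚ.0≤∣p∣ (seq y n)) x≤p)
               (*-monoʳ-≤ (ℚ.≤-trans (ℚ.0≤∣p∣ (seq x n)) x≤p) y≤q)))
  x⊑p y⊑q)

bounded : ∀ x → ∃[ B ] 0ℚ ℚ.< B × x ⊑ B
bounded x with cauchy x 1ℚ (ℚ.positive⁻¹ 1ℚ)
... | N , close =
  ℚ.∣ seq x N ∣ ℚ.+ 1ℚ , ℚ.+-mono-≤-< (ℚ.0≤∣p∣ (seq x N)) (ℚ.positive⁻¹ 1ℚ) ,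
  ⊑-intro (N , λ n N≤n → ℚ.≤-trans (∣p∣≤∣q∣+∣p-q∣ (seq x n) (seq x N))
    (ℚ.+-monoʳ-≤ ℚ.∣ seq x N ∣ (ℚ.<⇒≤ (close n N N≤n ℕ.≤-refl))))

≃⇒⊑ : ∀ x y → x ≃ y → ∀ {ε} → 0ℚ ℚ.< ε → x - y ⊑ ε
≃⇒⊑ x y x≃y ε>0 = ⊑-intro (map-eventually (λ n → ℚ.<⇒≤) (x≃y _ ε>0))

⊑⇒≃ : ∀ x y → (∀ {ε} → 0ℚ ℚ.< ε → x - y ⊑ ε) → x ≃ y
⊑⇒≃ x y x-y⊑ ε ε>0 =
  map-eventually (λ n le → ℚ.≤-<-trans le (½-< ε>0)) (⊑-elim (x-y⊑ (½-pos ε>0)))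

pointwise-≃ : ∀ x y → (∀ n → seq x n ≡ seq y n) → x ≃ y
pointwise-≃ x y x≡y = ⊑⇒≃ x y λ ε>0 → ⊑-weaken (ℚ.<⇒≤ ε>0)
  (⊑-const 0ℚ λ n → trans (cong (ℚ._- seq y n) (x≡y n)) (ℚ.+-inverseʳ (seq y n)))

⊑-resp : ∀ x y {p q} → x ≃ y → p ℚ.< q → x ⊑ p → y ⊑ q
⊑-resp x y {p} {q} x≃y p<q x⊑p = ⊑-weaken (ℚ.≤-reflexive (p+[q-p]≡q p q))
  (⊑-≡ (λ n → p+[q-p]≡q (seq x n) (seq y n))
    (⊑-+ x⊑p (≃⇒⊑ y x (≃-sym {x} {y} x≃y) (p<q⇒0<q-p p<q))))

-- The side of a threshold on which a real lies is undecidable, but a gap leaves room: late terms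
-- stay within η of the N-th, and comparing that single rational with a point m between p and q
-- settles the matter.
bounded-or-away : ∀ x {p q} → p ℚ.< q → x ⊑ q ⊎ Eventually λ n → p ℚ.≤ ℚ.∣ seq x n ∣
bounded-or-away x {p} {q} p<q
  with ℚ.<-dense p<q
... | m , p<m , m<q
  with common-lower-bound (p<q⇒0<q-p p<m) (p<q⇒0<q-p m<q)
... | η , η>0 , η≤m-p , η≤q-m
  with cauchy x η η>0
... | N , close
  with ℚ.≤-total ℚ.∣ seq x N ∣ m
... | inj₁ x≤m = inj₁ (⊑-intro (N , λ n N≤n → ℚ.≤-trans
        (∣p∣≤∣q∣+∣p-q∣ (seq x n) (seq x N))
        (subst (_ ℚ.≤_) (p+[q-p]≡q m q)
          (ℚ.+-mono-≤ x≤m (ℚ.≤-trans (ℚ.<⇒≤ (close n N N≤n ℕ.≤-refl)) η≤q-m)))))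
... | inj₂ m≤x = inj₂ (N , λ n N≤n → subst₂ ℚ._≤_
        (solve 2 (λ p m → m :- (m :- p) := p) refl p m)
        (solve 2 (λ a b → a :+ b :- b := a) refl ℚ.∣ seq x n ∣ (m ℚ.- p))
        (ℚ.+-monoˡ-≤ (ℚ.- (m ℚ.- p)) (ℚ.≤-trans m≤x (ℚ.≤-trans
          (∣p∣≤∣q∣+∣p-q∣ (seq x N) (seq x n))
          (ℚ.+-monoʳ-≤ ℚ.∣ seq x n ∣
            (ℚ.≤-trans (ℚ.<⇒≤ (close N n ℕ.≤-refl N≤n)) η≤m-p))))))

-- The gap pays for the double negation: by `bounded-or-away` the alternative to the bound q is that
-- |x| stays above some m > p, which refutes the bound p.
⊑-stable : ∀ {x p q} → p ℚ.< q → ¬ ¬ x ⊑ p → x ⊑ q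
⊑-stable {x} p<q ¬¬x⊑p with ℚ.<-dense p<q
... | m , p<m , m<q with bounded-or-away x m<q
... | inj₁ x⊑q  = x⊑q
... | inj₂ away = contradiction
  (λ x⊑p → let N , contra = zip-eventually
                 (λ n x≤p m≤x → ℚ.<-irrefl refl (ℚ.<-≤-trans p<m (ℚ.≤-trans m≤x x≤p)))
                 (⊑-elim x⊑p) away
           in contra N ℕ.≤-refl)
  ¬¬x⊑p

-- Tightness of apartness: if |x| stayed above ε/2, then x would be apart from 0, so
-- `bounded-or-away` leaves the bound ε.
¬#0⇒≃0 : ∀ x → ¬ (0ℝ < ∣ x ∣) → x ≃ 0ℝ
¬#0⇒≃0 x ¬x#0 = ⊑⇒≃ x 0ℝ small
  where
  small : ∀ {ε} → 0ℚ ℚ.< ε → x - 0ℝ ⊑ ε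
  small {ε} ε>0 = [ ⊑-≡ (λ n → sym (ℚ.+-identityʳ (seq x n))) , away⇒ ]′
    (bounded-or-away x (½-< ε>0))
    where
    away⇒ : Eventually (λ n → ½ ℚ.* ε ℚ.≤ ℚ.∣ seq x n ∣) → x - 0ℝ ⊑ ε
    away⇒ away = contradiction
      (½ ℚ.* ε , ½-pos ε>0 , map-eventually
        (λ n → subst (ℚ._≤ ℚ.∣ seq x n ∣) (sym (ℚ.+-identityˡ (½ ℚ.* ε)))) away) ¬x#0

+-cong : ∀ x y u v → x ≃ y → u ≃ v → x + u ≃ y + v
+-cong x y u v x≃y u≃v = ⊑⇒≃ (x + u) (y + v) λ {ε} ε>0 →
  ⊑-weaken (ℚ.≤-reflexive (½+½ ε))
    (⊑-≡ (λ n → solve 4 (λ x y u v → (x :- y) :+ (u :- v) := (x :+ u) :- (y :+ v)) refl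
                  (seq x n) (seq y n) (seq u n) (seq v n))
      (⊑-+ (≃⇒⊑ x y x≃y (½-pos ε>0)) (≃⇒⊑ u v u≃v (½-pos ε>0))))

-‿cong : ∀ x y → x ≃ y → - x ≃ - y
-‿cong x y x≃y = ⊑⇒≃ (- x) (- y) λ ε>0 →
  ⊑-≡ (λ n → solve 2 (λ x y → :- (x :- y) := :- x :- :- y) refl (seq x n) (seq y n))
    (⊑-neg (≃⇒⊑ x y x≃y ε>0))

*-cong : ∀ x y u v → x ≃ y → u ≃ v → x * u ≃ y * v
*-cong x y u v x≃y u≃v = ⊑⇒≃ (x * u) (y * v) λ {ε} ε>0 →
  let B , B>0 , x⊑B = bounded x
      C , C>0 , v⊑C = bounded v
      δ , δ>0 , [B+C]δ≡ε = quotient-pos (+-pos B>0 C>0) ε>0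
  in ⊑-weaken (ℚ.≤-reflexive (trans (sym (ℚ.*-distribʳ-+ δ B C)) [B+C]δ≡ε))
      (⊑-≡ (λ n → solve 4 (λ x y u v → x :* (u :- v) :+ v :* (x :- y) := x :* u :- y :* v) refl
                    (seq x n) (seq y n) (seq u n) (seq v n))
        (⊑-+ (⊑-* x⊑B (≃⇒⊑ u v u≃v δ>0)) (⊑-* v⊑C (≃⇒⊑ x y x≃y δ>0))))

ℝ-commutativeRing : CommutativeRing 0ℓ 0ℓ
ℝ-commutativeRing = record
  { Carrier = ℝ ; _≈_ = _≃_ ; _+_ = _+_ ; _*_ = _*_ ; -_ = -_ ; 0# = 0ℝ ; 1# = 1ℝ
  ; isCommutativeRing = record
    { isRing = record
      { +-isAbelianGroup = record
        { isGroup = record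
          { isMonoid = record
            { isSemigroup = record
              { isMagma = record
                { isEquivalence = Setoid.isEquivalence ℝ-setoid
                ; ∙-cong = λ {x y u v} → +-cong x y u v
                }
              ; assoc = λ x y z → pointwise-≃ (x + y + z) (x + (y + z))
                  λ n → ℚ.+-assoc (seq x n) (seq y n) (seq z n)
              }
            ; identity = (λ x → pointwise-≃ (0ℝ + x) x λ n → ℚ.+-identityˡ (seq x n))
                       , (λ x → pointwise-≃ (x + 0ℝ) x λ n → ℚ.+-identityʳ (seq x n))
            }
          ; inverse = (λ x → pointwise-≃ (- x + x) 0ℝ λ n → ℚ.+-inverseˡ (seq x n))
                    , (λ x → pointwise-≃ (x + - x) 0ℝ λ n → ℚ.+-inverseʳ (seq x n))
          ; ⁻¹-cong = λ {x y} → -‿cong x y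
          }
        ; comm = λ x y → pointwise-≃ (x + y) (y + x) λ n → ℚ.+-comm (seq x n) (seq y n)
        }
      ; *-cong = λ {x y u v} → *-cong x y u v
      ; *-assoc = λ x y z → pointwise-≃ (x * y * z) (x * (y * z))
          λ n → ℚ.*-assoc (seq x n) (seq y n) (seq z n)
      ; *-identity = (λ x → pointwise-≃ (1ℝ * x) x λ n → ℚ.*-identityˡ (seq x n))
                   , (λ x → pointwise-≃ (x * 1ℝ) x λ n → ℚ.*-identityʳ (seq x n))
      ; distrib = (λ x y z → pointwise-≃ (x * (y + z)) (x * y + x * z)
                      λ n → ℚ.*-distribˡ-+ (seq x n) (seq y n) (seq z n))
                , (λ x y z → pointwise-≃ ((y + z) * x) (y * x + z * x)
                      λ n → ℚ.*-distribʳ-+ (seq x n) (seq y n) (seq z n))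
      }
    ; *-comm = λ x y → pointwise-≃ (x * y) (y * x) λ n → ℚ.*-comm (seq x n) (seq y n)
    }
  }

functionRawRing : OpenInterval → RawRing 0ℓ 0ℓ
functionRawRing I = record
  { Carrier = RealFunction I
  ; _≈_     = λ f g → ∀ x → to f x ≃ to g x
  ; _+_     = λ f g → record
    { to   = λ x → to f x + to g x
    ; cong = λ {x y} x≃y →
        +-cong (to f x) (to f y) (to g x) (to g y) (Func.cong f x≃y) (Func.cong g x≃y)
    }
  ; _*_     = λ f g → record
    { to   = λ x → to f x * to g x
    ; cong = λ {x y} x≃y →
        *-cong (to f x) (to f y) (to g x) (to g y) (Func.cong f x≃y) (Func.cong g x≃y)
    }
  ; -_      = λ f → record
    { to   = λ x → - to f x
    ; cong = λ {x y} x≃y → -‿cong (to f x) (to f y) (Func.cong f x≃y)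
    }
  ; 0#      = record { to = λ _ → 0ℝ ; cong = λ _ → ≃-refl {0ℝ} }
  ; 1#      = record { to = λ _ → 1ℝ ; cong = λ _ → ≃-refl {1ℝ} }
  }

-- Equality of functions looks only at `to`, so `to` is a monomorphism into the ring of all maps
-- from points to reals, and the ring laws pull back along it.
functionRing : OpenInterval → CommutativeRing 0ℓ 0ℓ
functionRing I = record
  { RawRing (functionRawRing I)
  ; isCommutativeRing = RingMonomorphism.isCommutativeRing
      {R₁ = functionRawRing I} {R₂ = CommutativeRing.rawRing pointwiseRing} {⟦_⟧ = to}
      (record
        { isRingHomomorphism = record
          { isSemiringHomomorphism = record
            { isNearSemiringHomomorphism = record
              { +-isMonoidHomomorphism = record
                { isMagmaHomomorphism = record
                  { isRelHomomorphism = record { cong = λ f≈g → f≈g }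
                  ; homo = λ f g x → ≃-refl {to f x + to g x}
                  }
                ; ε-homo = λ x → ≃-refl {0ℝ}
                }
              ; *-homo = λ f g x → ≃-refl {to f x * to g x}
              }
            ; 1#-homo = λ x → ≃-refl {1ℝ}
            }
          ; -‿homo = λ f x → ≃-refl { - to f x }
          }
        ; injective = λ f≈g → f≈g
        })
      (CommutativeRing.isCommutativeRing pointwiseRing)
  }
  where
  pointwiseRing : CommutativeRing 0ℓ 0ℓ
  pointwiseRing = Pointwise.commutativeRing (Point I) ℝ-commutativeRing

-- Order on the reals and room inside an open interval

fromℚ-pos : ∀ {ε} → 0ℚ ℚ.< ε → 0ℝ < fromℚ ε
fromℚ-pos {ε} ε>0 = ε , ε>0 , 0 , λ _ _ → ℚ.≤-reflexive (ℚ.+-identityˡ ε)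

+½-absorb : ∀ p q r → p ℚ.≤ q ℚ.+ ½ ℚ.* r → p ℚ.+ ½ ℚ.* r ℚ.≤ q ℚ.+ r
+½-absorb p q r p≤ = ℚ.≤-trans (ℚ.+-monoˡ-≤ (½ ℚ.* r) p≤)
  (ℚ.≤-reflexive (trans (ℚ.+-assoc q (½ ℚ.* r) (½ ℚ.* r)) (cong (q ℚ.+_) (½+½ r))))

<-respʳ-≃ : ∀ x y z → y ≃ z → x < y → x < z
<-respʳ-≃ x y z y≃z (ε , ε>0 , x+ε≤y) = ½ ℚ.* ε , ½-pos ε>0 , zip-eventually
  (λ n x+ε≤y ∣y-z∣≤ → subst₂ ℚ._≤_
    (trans (cong (λ t → seq x n ℚ.+ t ℚ.- ½ ℚ.* ε) (sym (½+½ ε)))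
      (solve 2 (λ x e → x :+ (e :+ e) :- e := x :+ e) refl (seq x n) (½ ℚ.* ε)))
    (solve 2 (λ y z → y :- (y :- z) := z) refl (seq y n) (seq z n))
    (ℚ.+-mono-≤ x+ε≤y (ℚ.neg-antimono-≤ (ℚ.≤-trans (p≤∣p∣ (seq y n ℚ.- seq z n)) ∣y-z∣≤))))
  x+ε≤y (⊑-elim (≃⇒⊑ y z y≃z (½-pos ε>0)))

<-respˡ-≃ : ∀ x y z → x ≃ y → x < z → y < z
<-respˡ-≃ x y z x≃y (ε , ε>0 , x+ε≤z) = ½ ℚ.* ε , ½-pos ε>0 , zip-eventually
  (λ n x+ε≤z ∣y-x∣≤ → ℚ.≤-trans
    (+½-absorb (seq y n) (seq x n) ε (subst (ℚ._≤ seq x n ℚ.+ ½ ℚ.* ε) (p+[q-p]≡q (seq x n) (seq y n))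
      (ℚ.+-monoʳ-≤ (seq x n) (ℚ.≤-trans (p≤∣p∣ (seq y n ℚ.- seq x n)) ∣y-x∣≤))))
    x+ε≤z)
  x+ε≤z (⊑-elim (≃⇒⊑ y x (≃-sym {x} {y} x≃y) (½-pos ε>0)))

∈-resp-≃ : ∀ I x y → x ≃ y → x ∈ I → y ∈ I
∈-resp-≃ I x y x≃y (above , below) =
  All.map (λ {l} → <-respʳ-≃ l x y x≃y) above , All.map (λ {u} → <-respˡ-≃ x y u x≃y) below

x+[y-x]≃y : ∀ x y → x + (y - x) ≃ y
x+[y-x]≃y x y = pointwise-≃ (x + (y - x)) y λ n → p+[q-p]≡q (seq x n) (seq y n)

-- `HasDerivAt` measures increments by rationals, so a rational stand-in for |h| is needed. A late
-- term of |h| enlarged by η overestimates |h| by at most a factor 2, which keeps division by h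
-- under control.
rational-modulus : ∀ h → 0ℝ < ∣ h ∣ → ∀ {δ} → ∣ h ∣ < fromℚ δ → ∃[ r ] 0ℚ ℚ.< r × r ℚ.≤ δ ×
  h ⊑ r × Eventually (λ n → 0ℚ ℚ.< ℚ.∣ seq h n ∣ × ½ ℚ.* r ℚ.≤ ℚ.∣ seq h n ∣)
rational-modulus h (c , c>0 , K , c≤h) {δ} (s , s>0 , M , h+s≤δ) =
  -- η ≤ s keeps r within δ, and η ≤ c/2 gives r ≤ |hₙ| + 2η ≤ |hₙ| + c ≤ 2|hₙ|.
  let η , η>0 , η≤s , η≤½c = common-lower-bound s>0 (½-pos c>0)
      N , close = cauchy h η η>0
      L = (K ℕ.⊔ M) ℕ.⊔ N
      hL = ℚ.∣ seq h L ∣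
      near = λ n L≤n → close n L (ℕ.m⊔n≤o⇒n≤o (K ℕ.⊔ M) N L≤n) (ℕ.m≤n⊔m (K ℕ.⊔ M) N)
  in hL ℚ.+ η ,
     ℚ.+-mono-≤-< (ℚ.0≤∣p∣ (seq h L)) η>0 ,
     ℚ.≤-trans (ℚ.+-monoʳ-≤ hL η≤s)
       (h+s≤δ L (ℕ.≤-trans (ℕ.m≤n⊔m K M) (ℕ.m≤m⊔n (K ℕ.⊔ M) N))) ,
     ⊑-intro (L , λ n L≤n → ℚ.≤-trans (∣p∣≤∣q∣+∣p-q∣ (seq h n) (seq h L))
       (ℚ.+-monoʳ-≤ hL (ℚ.<⇒≤ (near n L≤n)))) ,
     (L , λ n L≤n →
       let hn = ℚ.∣ seq h n ∣
           c≤hn = subst (ℚ._≤ hn) (ℚ.+-identityˡ c) (c≤h n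
             (ℕ.m⊔n≤o⇒m≤o K M (ℕ.m⊔n≤o⇒m≤o (K ℕ.⊔ M) N L≤n)))
       in ℚ.<-≤-trans c>0 c≤hn ,
          half-bound {hL} {η} {hn} {c}
            (ℚ.≤-trans (∣p∣≤∣q∣+∣p-q∣ (seq h L) (seq h n))
              (ℚ.+-monoʳ-≤ hn (ℚ.<⇒≤ (close L n (ℕ.m≤n⊔m (K ℕ.⊔ M) N)
                (ℕ.m⊔n≤o⇒n≤o (K ℕ.⊔ M) N L≤n)))))
            η≤½c c≤hn)
  where
  half-bound : ∀ {a η b c} → a ℚ.≤ b ℚ.+ η → η ℚ.≤ ½ ℚ.* c → c ℚ.≤ b → ½ ℚ.* (a ℚ.+ η) ℚ.≤ b
  half-bound {a} {η} {b} {c} a≤b+η η≤½c c≤b = subst (½ ℚ.* (a ℚ.+ η) ℚ.≤_)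
    (trans (ℚ.*-distribˡ-+ ½ b b) (½+½ b))
    (*-monoʳ-≤ (ℚ.nonNegative⁻¹ ½) (ℚ.≤-trans (ℚ.+-monoˡ-≤ η a≤b+η)
      (subst (ℚ._≤ b ℚ.+ b) (sym (ℚ.+-assoc b η η))
        (ℚ.+-monoʳ-≤ b (ℚ.≤-trans (ℚ.+-mono-≤ η≤½c η≤½c)
          (ℚ.≤-trans (ℚ.≤-reflexive (½+½ c)) c≤b))))))

room-below : ∀ x (u : Maybe ℝ) → All (x <_) u →
             ∃[ ρ ] 0ℚ ℚ.< ρ × (∀ r → r ℚ.≤ ρ → All (x + fromℚ r <_) u)
room-below x nothing nothing = 1ℚ , ℚ.positive⁻¹ 1ℚ , λ _ _ → nothing
room-below x (just u) (just (e , e>0 , x+e≤u)) = ½ ℚ.* e , ½-pos e>0 , λ r r≤½e →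
  just (½ ℚ.* e , ½-pos e>0 , map-eventually
    (λ n → ℚ.≤-trans
      (+½-absorb (seq x n ℚ.+ r) (seq x n) e (ℚ.+-monoʳ-≤ (seq x n) r≤½e))) x+e≤u)

-- Supplies the test points for uniqueness of derivatives; steps to the right suffice.
x+r∈I : ∀ I {x} → x ∈ I → ∃[ ρ ] 0ℚ ℚ.< ρ × (∀ r → 0ℚ ℚ.< r → r ℚ.≤ ρ → x + fromℚ r ∈ I)
x+r∈I I {x} (above , below) with room-below x (upper I) below
... | ρ , ρ>0 , room = ρ , ρ>0 , λ r r>0 r≤ρ →
  All.map (λ (e , e>0 , l+e≤x) → e , e>0 , map-eventually
    (λ n l+e≤x → ℚ.≤-trans l+e≤x (p≤p+q (seq x n) (ℚ.<⇒≤ r>0))) l+e≤x) above ,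
  room r r≤ρ

-- Derivatives through linear remainders

module Derivative (I : OpenInterval) where

  remainder : RealFunction I → ℝ → Point I → Point I → ℝ
  remainder f d x x′ = (to f x′ - to f x) - d * (proj₁ x′ - proj₁ x)

  -- ∣f(x′) - f(x) - d (x′ - x)∣ ≤ ε ∣x′ - x∣ for x′ near x, with the rational r in place of
  -- ∣x′ - x∣; unlike in the difference quotient, x′ = x is allowed.
  record HasDerivAt (f : RealFunction I) (d : ℝ) (x : Point I) : Set where
    constructor differentiable
    field
      remainder-small : ∀ ε → 0ℚ ℚ.< ε → ∃[ δ ] 0ℚ ℚ.< δ ×
        (∀ r → 0ℚ ℚ.< r → r ℚ.≤ δ → ∀ x′ → proj₁ x′ - proj₁ x ⊑ r →
          remainder f d x x′ ⊑ ε ℚ.* r)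

  open HasDerivAt public

  remainder-cong : ∀ (f g : RealFunction I) d e x x′ x″ → (∀ x → to f x ≃ to g x) →
                   d ≃ e → proj₁ x′ ≃ proj₁ x″ → remainder f d x x′ ≃ remainder g e x x″
  remainder-cong f g d e x x′ x″ f≃g d≃e x′≃x″ =
    +-cong (to f x′ - to f x) (to g x″ - to g x)
           (- (d * (proj₁ x′ - proj₁ x))) (- (e * (proj₁ x″ - proj₁ x)))
      (+-cong (to f x′) (to g x″) (- to f x) (- to g x)
        (≃-trans {to f x′} {to f x″} {to g x″} (Func.cong f x′≃x″) (f≃g x″))
        (-‿cong (to f x) (to g x) (f≃g x)))
      (-‿cong (d * (proj₁ x′ - proj₁ x)) (e * (proj₁ x″ - proj₁ x))
        (*-cong d e (proj₁ x′ - proj₁ x) (proj₁ x″ - proj₁ x) d≃e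
          (+-cong (proj₁ x′) (proj₁ x″) (- proj₁ x) (- proj₁ x) x′≃x″ (≃-refl { - proj₁ x }))))

  HasDerivAt-resp : ∀ {f g : RealFunction I} {d e x} → (∀ x → to f x ≃ to g x) → d ≃ e →
                    HasDerivAt f d x → HasDerivAt g e x
  HasDerivAt-resp {f = f} {g} {d} {e} {x} f≃g d≃e f′ = differentiable λ ε ε>0 →
    let δ , δ>0 , small = remainder-small f′ (½ ℚ.* ε) (½-pos ε>0)
    in δ , δ>0 , λ r r>0 r≤δ x′ h⊑r → ⊑-resp (remainder f d x x′) (remainder g e x x′)
         (remainder-cong f g d e x x′ x′ f≃g d≃e (≃-refl {proj₁ x′}))
         (ℚ.*-monoˡ-<-pos r {{ℚ.positive r>0}} (½-< ε>0))
         (small r r>0 r≤δ x′ h⊑r)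

  -- One may argue by contradiction, as a bound is stable under double negation up to a loss;
  -- then either x′ - x is apart from 0, or x′ ≃ x.
  IsDerivative⇒HasDerivAt : ∀ {f f′} → IsDerivative I f f′ → ∀ x → HasDerivAt f (to f′ x) x
  IsDerivative⇒HasDerivAt {f} {f′} f-deriv x = differentiable λ ε ε>0 →
    let δ , (e , e>0 , e≤δ) , quotient-close = f-deriv x (fromℚ (½ ℚ.* ε)) (fromℚ-pos (½-pos ε>0))
    -- Eventually δ ≥ e, so |h| ≤ e/2 leaves the gap e/2 that the strict inequality |h| < δ
    -- requires.
    in ½ ℚ.* e , ½-pos e>0 , small {ε} {δ} {e} ε>0 e>0 e≤δ quotient-close
    where
    QuotientClose : ℚ → ℝ → Set
    QuotientClose ε δ = ∀ h (h#0 : 0ℝ < ∣ h ∣) → ∣ h ∣ < δ → (x+h∈I : proj₁ x + h ∈ I) →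
      ∣ (to f (proj₁ x + h , x+h∈I) - to f x) * inv h h#0 - to f′ x ∣ < fromℚ ε

    small : ∀ {ε δ e} → 0ℚ ℚ.< ε → 0ℚ ℚ.< e → Eventually (λ n → 0ℚ ℚ.+ e ℚ.≤ seq δ n) →
            QuotientClose (½ ℚ.* ε) δ →
            ∀ r → 0ℚ ℚ.< r → r ℚ.≤ ½ ℚ.* e → ∀ x′ → proj₁ x′ - proj₁ x ⊑ r →
            remainder f (to f′ x) x x′ ⊑ ε ℚ.* r
    small {ε} {δ} {e} ε>0 e>0 e≤δ quotient-close r r>0 r≤½e x′ h⊑r =
      -- p lies strictly between εr/2 and εr: the lower gap lets `near` pass from x + h to x′, the
      -- upper one pays for removing the double negation.
      let p , a<p , p<b = ℚ.<-dense (ℚ.*-monoˡ-<-pos r {{ℚ.positive r>0}} (½-< ε>0))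
      in ⊑-stable p<b λ rem⋢p →
         rem⋢p (at-0 a<p (¬#0⇒≃0 h λ h#0 → rem⋢p (near h#0 a<p)))
      where
      h : ℝ
      h = proj₁ x′ - proj₁ x

      x+h≃x′ : proj₁ x + h ≃ proj₁ x′
      x+h≃x′ = x+[y-x]≃y (proj₁ x) (proj₁ x′)

      x+h : Point I
      x+h = proj₁ x + h , ∈-resp-≃ I (proj₁ x′) (proj₁ x + h)
        (≃-sym {proj₁ x + h} {proj₁ x′} x+h≃x′) (proj₂ x′)

      ∣h∣<δ : ∣ h ∣ < δ
      ∣h∣<δ = ½ ℚ.* e , ½-pos e>0 , zip-eventually
        (λ n h≤r 0+e≤δ → ℚ.≤-trans
          (subst (ℚ.∣ seq h n ∣ ℚ.+ ½ ℚ.* e ℚ.≤_) (½+½ e)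
            (ℚ.+-monoˡ-≤ (½ ℚ.* e) (ℚ.≤-trans h≤r r≤½e)))
          (subst (ℚ._≤ seq δ n) (ℚ.+-identityˡ e) 0+e≤δ))
        (⊑-elim h⊑r) e≤δ

      near : 0ℝ < ∣ h ∣ → ∀ {p} → (½ ℚ.* ε) ℚ.* r ℚ.< p → remainder f (to f′ x) x x′ ⊑ p
      near h#0@(c , c>0 , c≤h) {p} a<p =
        ⊑-resp (remainder f (to f′ x) x x+h) (remainder f (to f′ x) x x′)
          (remainder-cong f f (to f′ x) (to f′ x) x x+h x′
            (λ x → ≃-refl {to f x}) (≃-refl {to f′ x}) x+h≃x′)
          a<p
          (⊑-≡ {F - to f′ x * h} seq-≡ (⊑-intro (zip-eventually seq-bound
            (zip-eventually (λ n → _,_) (proj₂ (proj₂ close)) c≤h) (⊑-elim h⊑r))))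
        where
        F : ℝ
        F = to f x+h - to f x

        close : ∣ F * inv h h#0 - to f′ x ∣ < fromℚ (½ ℚ.* ε)
        close = quotient-close h h#0 ∣h∣<δ (proj₂ x+h)

        seq-≡ : ∀ n → seq (F - to f′ x * h) n ≡ seq (remainder f (to f′ x) x x+h) n
        seq-≡ n = cong (λ t → seq F n ℚ.- seq (to f′ x) n ℚ.* t)
          (solve 2 (λ x h → h := (x :+ h) :- x) refl (seq (proj₁ x) n) (seq h n))

        seq-bound : ∀ n →
          ℚ.∣ seq F n ℚ.* recip (seq h n) ℚ.- seq (to f′ x) n ∣ ℚ.+ proj₁ close ℚ.≤ ½ ℚ.* ε ×
            0ℚ ℚ.+ c ℚ.≤ ℚ.∣ seq h n ∣ →
          ℚ.∣ seq h n ∣ ℚ.≤ r →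
          ℚ.∣ seq (F - to f′ x * h) n ∣ ℚ.≤ (½ ℚ.* ε) ℚ.* r
        seq-bound n (q+s≤½ε , 0+c≤h) h≤r = subst (ℚ._≤ (½ ℚ.* ε) ℚ.* r)
          (trans (sym (ℚ.∣p*q∣≡∣p∣*∣q∣ q (seq h n)))
            (cong ℚ.∣_∣ (quotient-remainder (seq F n) (seq (to f′ x) n)
              (ℚ.<-≤-trans c>0 (subst (ℚ._≤ ℚ.∣ seq h n ∣) (ℚ.+-identityˡ c) 0+c≤h)))))
          (ℚ.≤-trans (*-monoˡ-≤ (ℚ.0≤∣p∣ (seq h n)) q≤½ε)
                     (*-monoʳ-≤ (ℚ.<⇒≤ (½-pos ε>0)) h≤r))
          where
          q : ℚ
          q = seq F n ℚ.* recip (seq h n) ℚ.- seq (to f′ x) n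
          q≤½ε : ℚ.∣ q ∣ ℚ.≤ ½ ℚ.* ε
          q≤½ε = ℚ.≤-trans (p≤p+q ℚ.∣ q ∣ (ℚ.<⇒≤ (proj₁ (proj₂ close)))) q+s≤½ε

      at-0 : ∀ {p} → (½ ℚ.* ε) ℚ.* r ℚ.< p → h ≃ 0ℝ → remainder f (to f′ x) x x′ ⊑ p
      at-0 {p} a<p h≃0 = ⊑-resp (remainder f (to f′ x) x x) (remainder f (to f′ x) x x′)
        (remainder-cong f f (to f′ x) (to f′ x) x x x′
          (λ x → ≃-refl {to f x}) (≃-refl {to f′ x}) x≃x′)
        (ℚ.<-trans (*-pos (½-pos ε>0) r>0) a<p)
        (⊑-const 0ℚ λ n → solve 3 (λ f d x → (f :- f) :- d :* (x :- x) := con 0ℚ) refl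
          (seq (to f x) n) (seq (to f′ x) n) (seq (proj₁ x) n))
        where
        x≃x′ : proj₁ x ≃ proj₁ x′
        x≃x′ = ≃-trans {proj₁ x} {proj₁ x + 0ℝ} {proj₁ x′}
          (pointwise-≃ (proj₁ x) (proj₁ x + 0ℝ) λ n → sym (ℚ.+-identityʳ (seq (proj₁ x) n)))
          (≃-trans {proj₁ x + 0ℝ} {proj₁ x + h} {proj₁ x′}
            (+-cong (proj₁ x) (proj₁ x) 0ℝ h (≃-refl {proj₁ x}) (≃-sym {h} {0ℝ} h≃0))
            x+h≃x′)

  HasDerivAt⇒IsDerivative : ∀ {f f′} → (∀ x → HasDerivAt f (to f′ x) x) → IsDerivative I f f′
  HasDerivAt⇒IsDerivative {f} {f′} f-deriv x ε (e , e>0 , e≤ε) =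
    -- A remainder of at most (e/4) r, divided by |h| ≥ r/2, gives a quotient error of at most e/2;
    -- the other e/2 is the gap to ε.
    let δ , δ>0 , small = remainder-small (f-deriv x) (½ ℚ.* (½ ℚ.* e)) (½-pos (½-pos e>0))
    in fromℚ δ , fromℚ-pos δ>0 , quotient-close {δ} small
    where
    quotient-close : ∀ {δ} →
      (∀ r → 0ℚ ℚ.< r → r ℚ.≤ δ → ∀ x′ → proj₁ x′ - proj₁ x ⊑ r →
        remainder f (to f′ x) x x′ ⊑ (½ ℚ.* (½ ℚ.* e)) ℚ.* r) →
      ∀ h (h#0 : 0ℝ < ∣ h ∣) → ∣ h ∣ < fromℚ δ → (x+h∈I : proj₁ x + h ∈ I) →
      ∣ (to f (proj₁ x + h , x+h∈I) - to f x) * inv h h#0 - to f′ x ∣ < ε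
    quotient-close {δ} small h h#0 ∣h∣<δ x+h∈I = conclude (rational-modulus h h#0 ∣h∣<δ)
      where
      x′ : Point I
      x′ = proj₁ x + h , x+h∈I

      F : ℝ
      F = to f x′ - to f x

      x+h-x≡h : ∀ n → seq (proj₁ x′ - proj₁ x) n ≡ seq h n
      x+h-x≡h n = solve 2 (λ x h → (x :+ h) :- x := h) refl (seq (proj₁ x) n) (seq h n)

      conclude : (∃[ r ] 0ℚ ℚ.< r × r ℚ.≤ δ × h ⊑ r ×
                   Eventually (λ n → 0ℚ ℚ.< ℚ.∣ seq h n ∣ × ½ ℚ.* r ℚ.≤ ℚ.∣ seq h n ∣)) →
                 ∣ F * inv h h#0 - to f′ x ∣ < ε
      conclude (r , r>0 , r≤δ , h⊑r , ½r≤h) = ½ ℚ.* e , ½-pos e>0 , zip-eventually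
        (λ n q≤½e 0+e≤ε → ℚ.≤-trans
          (subst (ℚ.∣ q n ∣ ℚ.+ ½ ℚ.* e ℚ.≤_) (½+½ e) (ℚ.+-monoˡ-≤ (½ ℚ.* e) q≤½e))
          (subst (ℚ._≤ seq ε n) (ℚ.+-identityˡ e) 0+e≤ε))
        (zip-eventually q-bound
          (⊑-elim (small r r>0 r≤δ x′ (⊑-≡ (λ n → sym (x+h-x≡h n)) h⊑r))) ½r≤h)
        e≤ε
        where
        q : ℕ → ℚ
        q n = seq F n ℚ.* recip (seq h n) ℚ.- seq (to f′ x) n

        q-bound : ∀ n → ℚ.∣ seq (remainder f (to f′ x) x x′) n ∣ ℚ.≤ (½ ℚ.* (½ ℚ.* e)) ℚ.* r →
          0ℚ ℚ.< ℚ.∣ seq h n ∣ × ½ ℚ.* r ℚ.≤ ℚ.∣ seq h n ∣ → ℚ.∣ q n ∣ ℚ.≤ ½ ℚ.* e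
        q-bound n rem≤ (h>0 , ½r≤h) = ℚ.*-cancelʳ-≤-pos ℚ.∣ seq h n ∣ {{ℚ.positive h>0}}
          (ℚ.≤-trans
            (ℚ.≤-reflexive (trans (sym (ℚ.∣p*q∣≡∣p∣*∣q∣ (q n) (seq h n)))
              (cong ℚ.∣_∣ (trans (quotient-remainder (seq F n) (seq (to f′ x) n) h>0)
                (cong (λ t → seq F n ℚ.- seq (to f′ x) n ℚ.* t) (sym (x+h-x≡h n)))))))
            (ℚ.≤-trans rem≤ (ℚ.≤-trans
              (ℚ.≤-reflexive (solve 3 (λ h e r → (h :* e) :* r := e :* (h :* r)) refl
                ½ (½ ℚ.* e) r))
              (*-monoʳ-≤ (ℚ.<⇒≤ (½-pos e>0)) ½r≤h))))

  -- With ε = 1 the remainder is at most r, and d contributes at most C r, whence 1 + C. The product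
  -- and chain rules use this in place of continuity.
  lipschitz : ∀ {f : RealFunction I} {d x} → HasDerivAt f d x →
    ∃[ L ] 0ℚ ℚ.< L × ∃[ δ ] 0ℚ ℚ.< δ ×
      (∀ r → 0ℚ ℚ.< r → r ℚ.≤ δ → ∀ x′ → proj₁ x′ - proj₁ x ⊑ r → to f x′ - to f x ⊑ L ℚ.* r)
  lipschitz {f = f} {d} {x} f′ =
    let C , C>0 , d⊑C = bounded d
        δ , δ>0 , small = remainder-small f′ 1ℚ (ℚ.positive⁻¹ 1ℚ)
    in 1ℚ ℚ.+ C , +-pos (ℚ.positive⁻¹ 1ℚ) C>0 , δ , δ>0 , λ r r>0 r≤δ x′ h⊑r →
       ⊑-cast (⊑-+ (small r r>0 r≤δ x′ h⊑r) (⊑-* d⊑C h⊑r))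
         (sym (ℚ.*-distribʳ-+ r 1ℚ C))
         (λ n → solve 2 (λ a b → (a :- b) :+ b := a) refl
                  (seq (to f x′ - to f x) n) (seq (d * (proj₁ x′ - proj₁ x)) n))

  -- At the test point x + r both remainders share the increment of f, so their difference is (d -
  -- e) r. It is at most ε r, and the positive rational r cancels.
  HasDerivAt-unique : ∀ {f : RealFunction I} {d e x} →
                      HasDerivAt f d x → HasDerivAt f e x → d ≃ e
  HasDerivAt-unique {f} {d} {e} {x} f′ f″ = ⊑⇒≃ d e λ {ε} ε>0 →
    let δ₁ , δ₁>0 , d-small = remainder-small f′ (½ ℚ.* ε) (½-pos ε>0)
        δ₂ , δ₂>0 , e-small = remainder-small f″ (½ ℚ.* ε) (½-pos ε>0)
        ρ , ρ>0 , room = x+r∈I I {proj₁ x} (proj₂ x)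
        δ , δ>0 , δ≤δ₁ , δ≤δ₂ = common-lower-bound δ₁>0 δ₂>0
        r , r>0 , r≤δ , r≤ρ = common-lower-bound δ>0 ρ>0
        x′ = proj₁ x + fromℚ r , room r r>0 r≤ρ
        h≡r : ∀ n → seq (proj₁ x′ - proj₁ x) n ≡ r
        h≡r n = solve 2 (λ x r → (x :+ r) :- x := r) refl (seq (proj₁ x) n) r
        h⊑r = ⊑-weaken (ℚ.≤-reflexive (ℚ.0≤p⇒∣p∣≡p (ℚ.<⇒≤ r>0)))
                (⊑-const {proj₁ x′ - proj₁ x} r h≡r)
        difference = ⊑-+ (e-small r r>0 (ℚ.≤-trans r≤δ δ≤δ₂) x′ h⊑r)
                         (⊑-neg (d-small r r>0 (ℚ.≤-trans r≤δ δ≤δ₁) x′ h⊑r))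
    in ⊑-intro (map-eventually (λ n → bound {ε} {r} r>0 (seq (to f x′ - to f x) n)
         (seq d n) (seq e n) (h≡r n)) (⊑-elim difference))
    where
    bound : ∀ {ε r} → 0ℚ ℚ.< r → ∀ F d e {h} → h ≡ r →
            ℚ.∣ (F ℚ.- e ℚ.* h) ℚ.+ (ℚ.- (F ℚ.- d ℚ.* h)) ∣ ℚ.≤ (½ ℚ.* ε) ℚ.* r ℚ.+ (½ ℚ.* ε) ℚ.* r →
            ℚ.∣ d ℚ.- e ∣ ℚ.≤ ε
    bound {ε} {r} r>0 F d e refl le = ℚ.*-cancelʳ-≤-pos r {{ℚ.positive r>0}} (subst₂ ℚ._≤_
      (trans (cong ℚ.∣_∣ (solve 4 (λ F d e r → (F :- e :* r) :+ (:- (F :- d :* r)) :=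
                                           (d :- e) :* r) refl F d e r))
        (trans (ℚ.∣p*q∣≡∣p∣*∣q∣ (d ℚ.- e) r)
               (cong (ℚ.∣ d ℚ.- e ∣ ℚ.*_) (ℚ.0≤p⇒∣p∣≡p (ℚ.<⇒≤ r>0)))))
      (trans (sym (ℚ.*-distribʳ-+ r (½ ℚ.* ε) (½ ℚ.* ε))) (cong (ℚ._* r) (½+½ ε)))
      le)

  deriv-unique : ∀ {f : RealFunction I} (f∞ h∞ : Smooth I f) n x →
                 to (deriv {I} f∞ n) x ≃ to (deriv {I} h∞ n) x
  deriv-unique {f} f∞ h∞ zero    x = ≃-trans {to (deriv {I} f∞ 0) x} {to f x} {to (deriv {I} h∞ 0) x}
    (deriv-zero f∞ x) (≃-sym {to (deriv {I} h∞ 0) x} {to f x} (deriv-zero h∞ x))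
  deriv-unique {f} f∞ h∞ (suc n) x = HasDerivAt-unique {deriv {I} h∞ n}
    {to (deriv {I} f∞ (suc n)) x} {to (deriv {I} h∞ (suc n)) x} {x}
    (HasDerivAt-resp {deriv {I} f∞ n} {deriv {I} h∞ n}
      {to (deriv {I} f∞ (suc n)) x} {to (deriv {I} f∞ (suc n)) x} {x}
      (deriv-unique f∞ h∞ n) (≃-refl {to (deriv {I} f∞ (suc n)) x})
      (IsDerivative⇒HasDerivAt {deriv {I} f∞ n} {deriv {I} f∞ (suc n)} (deriv-suc f∞ n) x))
    (IsDerivative⇒HasDerivAt {deriv {I} h∞ n} {deriv {I} h∞ (suc n)} (deriv-suc h∞ n) x)

  -- Differentiation as a derivation: constants, sums and products

  _HasDeriv_ : RealFunction I → RealFunction I → Set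
  f HasDeriv f′ = ∀ x → HasDerivAt f (to f′ x) x

  open CommutativeRing (functionRing I) using (0#; 1#) renaming (_≈_ to _≈ᶠ_; _+_ to _+ᶠ_; _*_ to _*ᶠ_)

  HasDeriv-const : ∀ q (f : RealFunction I) → (∀ x n → seq (to f x) n ≡ q) → f HasDeriv 0#
  HasDeriv-const q f f≡q x = differentiable λ ε ε>0 → 1ℚ , ℚ.positive⁻¹ 1ℚ , λ r r>0 _ x′ _ →
    ⊑-weaken (ℚ.<⇒≤ (*-pos ε>0 r>0)) (⊑-const 0ℚ λ n →
      trans (cong₂ (λ a b → (a ℚ.- b) ℚ.- 0ℚ ℚ.* seq (proj₁ x′ - proj₁ x) n) (f≡q x′ n) (f≡q x n))
        (solve 2 (λ q h → (q :- q) :- con 0ℚ :* h := con 0ℚ) refl q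
          (seq (proj₁ x′ - proj₁ x) n)))

  HasDeriv-+ : ∀ {f g f′ g′ : RealFunction I} →
               f HasDeriv f′ → g HasDeriv g′ → (f +ᶠ g) HasDeriv (f′ +ᶠ g′)
  HasDeriv-+ {f} {g} {f′} {g′} Df Dg x = differentiable λ ε ε>0 →
    let δ₁ , δ₁>0 , f-small = remainder-small (Df x) (½ ℚ.* ε) (½-pos ε>0)
        δ₂ , δ₂>0 , g-small = remainder-small (Dg x) (½ ℚ.* ε) (½-pos ε>0)
        δ , δ>0 , δ≤δ₁ , δ≤δ₂ = common-lower-bound δ₁>0 δ₂>0
    in δ , δ>0 , λ r r>0 r≤δ x′ h⊑r →
         ⊑-cast
           (⊑-+ (f-small r r>0 (ℚ.≤-trans r≤δ δ≤δ₁) x′ h⊑r)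
                (g-small r r>0 (ℚ.≤-trans r≤δ δ≤δ₂) x′ h⊑r))
           (trans (sym (ℚ.*-distribʳ-+ r (½ ℚ.* ε) (½ ℚ.* ε))) (cong (ℚ._* r) (½+½ ε)))
           (λ n → solve 7
             (λ f₁ f g₁ g d e h → ((f₁ :- f) :- d :* h) :+ ((g₁ :- g) :- e :* h) :=
                                  ((f₁ :+ g₁) :- (f :+ g)) :- (d :+ e) :* h) refl
             (seq (to f x′) n) (seq (to f x) n) (seq (to g x′) n) (seq (to g x) n)
             (seq (to f′ x) n) (seq (to g′ x) n) (seq (proj₁ x′ - proj₁ x) n))

  -- The derivative is written with the projections of functionRing I so that the type agrees
  -- syntactically with that of D-*: unfolding either would compare proofs of Cauchyness.
  HasDeriv-* : ∀ {f g f′ g′ : RealFunction I} →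
               f HasDeriv f′ → g HasDeriv g′ → (f *ᶠ g) HasDeriv
               CommutativeRing._+_ (functionRing I)
                 (CommutativeRing._*_ (functionRing I) f′ g)
                 (CommutativeRing._*_ (functionRing I) f g′)
  HasDeriv-* {f} {g} {f′} {g′} Df Dg x = differentiable λ ε ε>0 →
    let L , L>0 , δ₁ , δ₁>0 , f-lipschitz = lipschitz {f = f} (Df x)
        M , M>0 , δ₂ , δ₂>0 , g-lipschitz = lipschitz {f = g} (Dg x)
        B , B>0 , f⊑B = bounded (to f x)
        C , C>0 , g⊑C = bounded (to g x)
        -- The remainder of the product is g · rem f + f · rem g plus the product of the two
        -- increments. The latter is at most L r · M η because r ≤ η, hence K = C + B + L M.
        η , η>0 , Kη≡ε = quotient-pos (+-pos (+-pos C>0 B>0) (*-pos L>0 M>0)) ε>0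
        δ₃ , δ₃>0 , f-small = remainder-small (Df x) η η>0
        δ₄ , δ₄>0 , g-small = remainder-small (Dg x) η η>0
        δ₁₂ , δ₁₂>0 , δ₁₂≤δ₁ , δ₁₂≤δ₂ = common-lower-bound δ₁>0 δ₂>0
        δ₃₄ , δ₃₄>0 , δ₃₄≤δ₃ , δ₃₄≤δ₄ = common-lower-bound δ₃>0 δ₄>0
        δ₁₄ , δ₁₄>0 , δ₁₄≤δ₁₂ , δ₁₄≤δ₃₄ = common-lower-bound δ₁₂>0 δ₃₄>0
        δ , δ>0 , δ≤δ₁₄ , δ≤η = common-lower-bound δ₁₄>0 η>0
    in δ , δ>0 , λ r r>0 r≤δ x′ h⊑r →
       let r≤δ₁₂ = ℚ.≤-trans r≤δ (ℚ.≤-trans δ≤δ₁₄ δ₁₄≤δ₁₂)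
           r≤δ₃₄ = ℚ.≤-trans r≤δ (ℚ.≤-trans δ≤δ₁₄ δ₁₄≤δ₃₄)
         in ⊑-cast
              (⊑-+ (⊑-+ (⊑-* g⊑C (f-small r r>0 (ℚ.≤-trans r≤δ₃₄ δ₃₄≤δ₃) x′ h⊑r))
                        (⊑-* f⊑B (g-small r r>0 (ℚ.≤-trans r≤δ₃₄ δ₃₄≤δ₄) x′ h⊑r)))
                   (⊑-* (f-lipschitz r r>0 (ℚ.≤-trans r≤δ₁₂ δ₁₂≤δ₁) x′ h⊑r)
                        (⊑-weaken (*-monoʳ-≤ (ℚ.<⇒≤ M>0) (ℚ.≤-trans r≤δ δ≤η))
                          (g-lipschitz r r>0 (ℚ.≤-trans r≤δ₁₂ δ₁₂≤δ₂) x′ h⊑r))))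
              (trans
                (solve 6 (λ C B L M η r → (C :* (η :* r) :+ B :* (η :* r)) :+ (L :* r) :* (M :* η) :=
                                          ((C :+ B) :+ L :* M) :* η :* r) refl C B L M η r)
                (cong (ℚ._* r) Kη≡ε))
              (λ n → solve 7
                (λ f₁ f g₁ g d e h →
                  (g :* ((f₁ :- f) :- d :* h) :+ f :* ((g₁ :- g) :- e :* h)) :+
                    (f₁ :- f) :* (g₁ :- g) :=
                  (f₁ :* g₁ :- f :* g) :- (d :* g :+ f :* e) :* h) refl
                (seq (to f x′) n) (seq (to f x) n) (seq (to g x′) n) (seq (to g x) n)
                (seq (to f′ x) n) (seq (to g′ x) n) (seq (proj₁ x′ - proj₁ x) n))

  HasDeriv-resp : ∀ {f g f′ g′ : RealFunction I} →
                  f ≈ᶠ g → f′ ≈ᶠ g′ → f HasDeriv f′ → g HasDeriv g′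
  HasDeriv-resp {f} {g} {f′} {g′} f≈g f′≈g′ Df x =
    HasDerivAt-resp {f} {g} {to f′ x} {to g′ x} f≈g (f′≈g′ x) (Df x)

  HasDeriv-isDerivation : FormalPowerSeries.IsDerivation (functionRing I) _HasDeriv_
  HasDeriv-isDerivation = record
    { D-resp = λ {a} {b} {a′} {b′} → HasDeriv-resp {a} {b} {a′} {b′}
    ; D-0    = HasDeriv-const 0ℚ 0# λ _ _ → refl
    ; D-1    = HasDeriv-const 1ℚ 1# λ _ _ → refl
    ; D-+    = λ {a} {b} {a′} {b′} → HasDeriv-+ {a} {b} {a′} {b′}
    ; D-*    = λ {a} {b} {a′} {b′} → HasDeriv-* {a} {b} {a′} {b′}
    }

-- The chain rule

module _ (I J : OpenInterval) where
  private
    module I = Derivative I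
    module J = Derivative J

  -- The remainder of g ∘ y is that of g at the increment y(x′) - y(x) plus e times that of y.
  -- `lipschitz` bounds the increment by a positive rational, so a vanishing increment does no harm.
  HasDerivAt-chain : ∀ (y : Func ⟪ I ⟫ ⟪ J ⟫) (g : RealFunction J) {d e x} →
    I.HasDerivAt (inclusion J ∘ y) d x → J.HasDerivAt g e (to y x) → I.HasDerivAt (g ∘ y) (e * d) x
  HasDerivAt-chain y g {d} {e} {x} y′ g′ = I.differentiable λ ε ε>0 →
    let L , L>0 , δ₁ , δ₁>0 , y-lipschitz = I.lipschitz {f = inclusion J ∘ y} y′
        C , C>0 , e⊑C = bounded e
        η , η>0 , [L+C]η≡ε = quotient-pos (+-pos L>0 C>0) ε>0
        δ₂ , δ₂>0 , y-small = I.remainder-small y′ η η>0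
        δ₃ , δ₃>0 , g-small = J.remainder-small g′ η η>0
        -- The increment of y is at most L r, so r ≤ δ₃/L brings it within the range where the bound
        -- for g holds.
        δ₄ , δ₄>0 , Lδ₄≡δ₃ = quotient-pos L>0 δ₃>0
        δ₅ , δ₅>0 , δ₅≤δ₁ , δ₅≤δ₂ = common-lower-bound δ₁>0 δ₂>0
        δ , δ>0 , δ≤δ₅ , δ≤δ₄ = common-lower-bound δ₅>0 δ₄>0
    in δ , δ>0 , λ r r>0 r≤δ x′ h⊑r →
       let r≤δ₁ = ℚ.≤-trans r≤δ (ℚ.≤-trans δ≤δ₅ δ₅≤δ₁)
           r≤δ₂ = ℚ.≤-trans r≤δ (ℚ.≤-trans δ≤δ₅ δ₅≤δ₂)
           Lr≤δ₃ = ℚ.≤-trans (*-monoʳ-≤ (ℚ.<⇒≤ L>0) (ℚ.≤-trans r≤δ δ≤δ₄)) (ℚ.≤-reflexive Lδ₄≡δ₃)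
       in ⊑-cast
            (⊑-+ (g-small (L ℚ.* r) (*-pos L>0 r>0) Lr≤δ₃ (to y x′)
                   (⊑-≡ {to (inclusion J ∘ y) x′ - to (inclusion J ∘ y) x}
                        {proj₁ (to y x′) - proj₁ (to y x)} (λ _ → refl)
                     (y-lipschitz r r>0 r≤δ₁ x′ h⊑r)))
                 (⊑-* e⊑C (y-small r r>0 r≤δ₂ x′ h⊑r)))
            (trans
              (solve 4 (λ η L r C → η :* (L :* r) :+ C :* (η :* r) := (L :+ C) :* η :* r) refl
                η L r C)
              (cong (ℚ._* r) [L+C]η≡ε))
            (λ n → solve 7
              (λ g′ g e y′ y d h → ((g′ :- g) :- e :* (y′ :- y)) :+ e :* ((y′ :- y) :- d :* h) :=
                                   (g′ :- g) :- (e :* d) :* h) refl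
              (seq (to g (to y x′)) n) (seq (to g (to y x)) n) (seq e n)
              (seq (proj₁ (to y x′)) n) (seq (proj₁ (to y x)) n) (seq d n)
              (seq (proj₁ x′ - proj₁ x) n))

-- Inverse factorials as functions, and evaluation of series at a point

module _ (I : OpenInterval) where

  private
    module FPS = FormalPowerSeries (functionRing I)

  1/_! : ℕ → RealFunction I
  1/ n ! = record
    { to   = λ _ → fromℚ ((+ 1 ℚ./ (n !)) {{n ℕ.!≢0}})
    ; cong = λ _ → ≃-refl {fromℚ ((+ 1 ℚ./ (n !)) {{n ℕ.!≢0}})}
    }

  seq-ν : ∀ n x k → seq (to (FPS.ν n) x) k ≡ + n ℚ./ 1
  seq-ν zero    x k = refl
  seq-ν (suc n) x k = trans (cong (1ℚ ℚ.+_) (seq-ν n x k)) (1+n/1 n)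

  1/suc-! : ∀ n x → to (FPS.ν (suc n)) x * to (1/ (suc n) !) x ≃ to (1/ n !) x
  1/suc-! n x = pointwise-≃ (to (FPS.ν (suc n)) x * to (1/ (suc n) !) x) (to (1/ n !) x) λ k →
    trans (cong (ℚ._* (+ 1 ℚ./ (suc n !)) {{suc n ℕ.!≢0}}) (seq-ν (suc n) x k))
      (m*1/md n (n !) {{n ℕ.!≢0}} {{suc n ℕ.!≢0}})

  module _ (x : Point I) where

    eval-∑ : ∀ n {a : ℕ → RealFunction I} {b} → (∀ k → to (a k) x ≃ b k) →
             to (FPS.∑ n a) x ≃ ∑≤ n b
    eval-∑ zero            a≃b = a≃b 0
    eval-∑ (suc n) {a} {b} a≃b = +-cong (to (FPS.∑ n a) x) (∑≤ n b) (to (a (suc n)) x) (b (suc n))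
      (eval-∑ n {a} {b} a≃b) (a≃b (suc n))

    module _ {Y : ℕ → RealFunction I} {Y′ : PowerSeries} (Y≃ : ∀ n → to (Y n) x ≃ Y′ n) where

      eval-^ : ∀ k n → to ((Y FPS.^ k) n) x ≃ (Y′ ^ k) n
      eval-^ zero    zero    = ≃-refl {1ℝ}
      eval-^ zero    (suc n) = ≃-refl {0ℝ}
      eval-^ (suc k) n       = eval-∑ n λ j →
        *-cong (to (Y j) x) (Y′ j) (to ((Y FPS.^ k) (n ℕ.∸ j)) x) ((Y′ ^ k) (n ℕ.∸ j))
          (Y≃ j) (eval-^ k (n ℕ.∸ j))

      eval-compose : ∀ {G : ℕ → RealFunction I} {G′ : PowerSeries} → (∀ n → to (G n) x ≃ G′ n) →
        (Y′₀≃0 : Y′ 0 ≃ 0ℝ) → ∀ n → to (FPS.compose G Y n) x ≃ substitute G′ Y′ Y′₀≃0 n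
      eval-compose {G} {G′} G≃ _ n = eval-∑ n λ k →
        *-cong (to (G k) x) (G′ k) (to ((Y FPS.^ k) n) x) ((Y′ ^ k) n) (G≃ k) (eval-^ k n)

-- The derivatives of the composite

module FaàDiBruno (I J : OpenInterval) (y : Func ⟪ I ⟫ ⟪ J ⟫) (g : RealFunction J)
                  (y∞ : Smooth I (inclusion J ∘ y)) (g∞ : Smooth J g) where

  private
    module FPS = FormalPowerSeries (functionRing I)
    module I = Derivative I
    module J = Derivative J

    g⁽_⁾ : ℕ → RealFunction I
    g⁽ n ⁾ = deriv g∞ n ∘ y

  HasDeriv-g∘y : ∀ n → g⁽ n ⁾ I.HasDeriv CommutativeRing._*_ (functionRing I) g⁽ suc n ⁾ (deriv y∞ 1)
  HasDeriv-g∘y n x =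
    I.HasDerivAt-resp {g⁽ n ⁾} {g⁽ n ⁾} {to (deriv g∞ (suc n)) (to y x) * to (deriv y∞ 1) x}
      {to (CommutativeRing._*_ (functionRing I) g⁽ suc n ⁾ (deriv y∞ 1)) x} {x}
      (λ x → ≃-refl {to g⁽ n ⁾ x})
      (pointwise-≃ (to (deriv g∞ (suc n)) (to y x) * to (deriv y∞ 1) x)
        (to (CommutativeRing._*_ (functionRing I) g⁽ suc n ⁾ (deriv y∞ 1)) x) λ _ → refl)
      (HasDerivAt-chain I J y (deriv g∞ n) {to (deriv y∞ 1) x} {to (deriv g∞ (suc n)) (to y x)} {x}
        -- The chain rule concerns y itself, while `deriv-suc` speaks of `deriv y∞ 0`; `deriv-zero`
        -- identifies them.
        (I.HasDerivAt-resp {deriv y∞ 0} {inclusion J ∘ y} {to (deriv y∞ 1) x} {to (deriv y∞ 1) x}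
          (deriv-zero y∞) (≃-refl {to (deriv y∞ 1) x})
          (I.IsDerivative⇒HasDerivAt {deriv y∞ 0} {deriv y∞ 1} (deriv-suc y∞ 0) x))
        (J.IsDerivative⇒HasDerivAt {deriv g∞ n} {deriv g∞ (suc n)} (deriv-suc g∞ n) (to y x)))

  -- The derivatives of g enter already composed with y, so all coefficients lie in the single ring
  -- of functions on I.
  open FPS.IsDerivation.Chain I.HasDeriv-isDerivation {1/_! I} {g⁽_⁾} {deriv {I} y∞}
    (λ _ → ≃-refl {1ℝ}) (1/suc-! I)
    (λ n → I.HasDeriv-const ((+ 1 ℚ./ (n !)) {{n ℕ.!≢0}}) ((1/ I !) n) λ _ _ → refl)
    (λ n → I.IsDerivative⇒HasDerivAt {deriv y∞ (suc n)} {deriv y∞ (suc (suc n))}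
             (deriv-suc y∞ (suc n)))
    HasDeriv-g∘y
    public

  -- `chain` does double duty: it witnesses smoothness here, and in `taylor-composite` uniqueness
  -- identifies any given sequence of derivatives of g ∘ y with it.
  composite-smooth : Smooth I (g ∘ y)
  composite-smooth = record
    { deriv      = chain
    ; deriv-zero = λ x → ≃-trans {to (chain 0) x} {to (deriv g∞ 0) (to y x)} {to g (to y x)}
        (chain-0 x) (deriv-zero g∞ (to y x))
    ; deriv-suc  = λ n → I.HasDerivAt⇒IsDerivative {chain n} {chain (suc n)} (D-chain n)
    }

  taylor-composite : (f∞ : Smooth I (g ∘ y)) (x : Point I) →
    taylor f∞ x ≈ substitute (taylor g∞ (to y x)) (taylor₊ y∞ x) (≃-refl {0ℝ})
  taylor-composite f∞ x n =
    ≃-trans {taylor f∞ x n} {to (series n) x}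
      {substitute (taylor g∞ (to y x)) (taylor₊ y∞ x) (≃-refl {0ℝ}) n}
      (taylor-chain {deriv {I} f∞} (I.deriv-unique f∞ composite-smooth) n x)
      (eval-compose I x {FPS.taylor₊ (1/_! I) (deriv {I} y∞)} {taylor₊ y∞ x} taylor₊-≃
        {FPS.taylor (1/_! I) g⁽_⁾} {taylor g∞ (to y x)}
        (λ k → ≃-refl {taylor g∞ (to y x) k}) (≃-refl {0ℝ}) n)
    where
    taylor₊-≃ : ∀ k → to (FPS.taylor₊ (1/_! I) (deriv {I} y∞) k) x ≃ taylor₊ y∞ x k
    taylor₊-≃ zero    = ≃-refl {0ℝ}
    taylor₊-≃ (suc k) = ≃-refl {taylor₊ y∞ x (suc k)}

theorem3p1 : (I J : OpenInterval)
    (y : Func ⟪ I ⟫ ⟪ J ⟫) (g : Func ⟪ J ⟫ ℝ-setoid)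
    (y∞ : Smooth I (inclusion J ∘ y)) (g∞ : Smooth J g) →
    Smooth I (g ∘ y) ×
    (∀ (f∞ : Smooth I (g ∘ y)) (x : Point I) →
    taylor f∞ x ≈ substitute (taylor g∞ (Func.to y x)) (taylor₊ y∞ x) (≃-refl {0ℝ}))
theorem3p1 I J y g y∞ g∞ = composite-smooth , taylor-composite
  where open FaàDiBruno I J y g y∞ g∞
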